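{- Let $p\ge 3$ be an odd integer. Then the minimum number of copies of $B_p$ in a graph of order $p+2$ and size $\mathrm{ex}(p+2,B_p)+1$ is $3$, and the minimum number of copies of $B_p$ in a graph of order $p+3$ and size $\mathrm{ex}(p+3,B_p)+1$ is $3(p+1)$.
   Context: All graphs are finite and simple. The order of a graph is its number of vertices and its size is its number of edges. A copy of $H$ in $G$ is a subgraph of $G$ isomorphic to $H$; the number of copies of $H$ in $G$ is the number of distinct subgraphs of $G$ isomorphic to $H$. For a graph $H$ and a positive integer $n$, the Turán number $\mathrm{ex}(n,H)$ is the maximum size of a simple graph of order $n$ containing no copy of $H$. The book $B_p$ with $p$ pages is the graph consisting of $p$ triangles sharing a common edge (so $B_p$ has $p+2$ vertices and $2p+1$ edges). -}

module Defs where

open import Data.Bool using (Bool; true; false)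
import Data.Bool.Properties as Bool
open import Data.Fin using (Fin; zero; suc; _<_; _<?_)
open import Data.Fin.Properties using (all?; any?; _≟_)
open import Data.Fin.Subset using (Subset; _∈_)
open import Data.Fin.Subset.Properties using (_∈?_)
open import Data.List using (List; []; _∷_; length; filter; allFin; cartesianProduct; cartesianProductWith)
open import Data.List.Membership.Propositional using () renaming (_∈_ to _∈ˡ_)
open import Data.List.Membership.Propositional.Properties
  using (∈-cartesianProductWith⁺; ∈-filter⁺; ∈-filter⁻; ∈-allFin)
open import Data.List.Relation.Unary.All using ([]; _∷_)
open import Data.List.Relation.Unary.AllPairs using ([]; _∷_)
open import Data.List.Relation.Unary.Any using (here; there)
open import Data.List.Relation.Unary.Unique.Propositional using (Unique)
import Data.List.Relation.Unary.Unique.Propositional.Properties as Unique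
open import Data.Nat using (ℕ; zero; suc; _+_; _≤_)
open import Data.Product using (Σ; ∃; ∃-syntax; _×_; _,_; proj₂)
open import Data.Vec using (Vec; []; _∷_; lookup; tabulate)
open import Data.Vec.Properties using (lookup∘tabulate; ∷-injective)
open import Function using (Injective; _⇔_; mk⇔)
open import Level using (Level)
open import Relation.Binary.PropositionalEquality
  using (_≡_; _≗_; refl; sym; trans; cong₂; subst)
open import Relation.Nullary using (¬_; Dec)
open import Relation.Nullary.Decidable using (_×-dec_; _→-dec_; map′)
open import Relation.Unary using (Pred; Decidable)

private
  variable
    a ℓ : Level
    A : Set a
    h n : ℕ

record Graph (n : ℕ) : Set where
  field
    adj         : Fin n → Fin n → Bool
    symmetric   : ∀ i j → adj i j ≡ adj j i
    irreflexive : ∀ i → adj i i ≡ false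

open Graph public

-- An edge {i , j} is listed once, as the pair (i , j) with i < j.
edges : Graph n → List (Fin n × Fin n)
edges {n} G =
  filter (λ (i , j) → (i <? j) ×-dec (adj G i j Bool.≟ true))
         (cartesianProduct (allFin n) (allFin n))

size : Graph n → ℕ
size G = length (edges G)

-- Vertices 0 and 1 span the common edge; vertex 2 + i is the apex of the
-- i-th triangle.
Book : ∀ p → Graph (2 + p)
Book p = record { adj = E ; symmetric = E-sym ; irreflexive = E-irrefl }
  where
  E : Fin (2 + p) → Fin (2 + p) → Bool
  E zero          zero          = false
  E zero          (suc _)       = true
  E (suc _)       zero          = true
  E (suc zero)    (suc zero)    = false
  E (suc zero)    (suc (suc _)) = true
  E (suc (suc _)) (suc zero)    = true
  E (suc (suc _)) (suc (suc _)) = false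

  E-sym : ∀ i j → E i j ≡ E j i
  E-sym zero          zero          = refl
  E-sym zero          (suc _)       = refl
  E-sym (suc _)       zero          = refl
  E-sym (suc zero)    (suc zero)    = refl
  E-sym (suc zero)    (suc (suc _)) = refl
  E-sym (suc (suc _)) (suc zero)    = refl
  E-sym (suc (suc _)) (suc (suc _)) = refl

  E-irrefl : ∀ i → E i i ≡ false
  E-irrefl zero          = refl
  E-irrefl (suc zero)    = refl
  E-irrefl (suc (suc _)) = refl

-- A vertex set together with an adjacency matrix on the ambient vertices.
-- Both are first-order data, so distinct subgraphs are those that differ
-- for _≡_.
record Sub (n : ℕ) : Set where
  constructor _,ₛ_
  field
    vertices : Subset n
    matrix   : Vec (Subset n) n

  joined : Fin n → Fin n → Bool
  joined i j = lookup (lookup matrix i) j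

open Sub public

IsSubgraph : Graph n → Sub n → Set
IsSubgraph G S =
    (∀ i j → joined S i j ≡ joined S j i)
  × (∀ i j → joined S i j ≡ true →
       adj G i j ≡ true × i ∈ vertices S × j ∈ vertices S)

IsIsomorphism : Graph h → Sub n → (Fin h → Fin n) → Set
IsIsomorphism H S f =
    Injective _≡_ _≡_ f
  × (∀ i → f i ∈ vertices S)
  × (∀ v → v ∈ vertices S → ∃[ i ] f i ≡ v)
  × (∀ i j → adj H i j ≡ joined S (f i) (f j))

IsCopy : Graph h → Graph n → Sub n → Set
IsCopy H G S = IsSubgraph G S × ∃[ f ] IsIsomorphism H S f

vectors : List A → ∀ n → List (Vec A n)
vectors xs zero    = [] ∷ []
vectors xs (suc n) = cartesianProductWith _∷_ xs (vectors xs n)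

∈-vectors : {xs : List A} → (∀ x → x ∈ˡ xs) → (v : Vec A n) → v ∈ˡ vectors xs n
∈-vectors all []      = here refl
∈-vectors all (x ∷ v) = ∈-cartesianProductWith⁺ _∷_ (all x) (∈-vectors all v)

vectors-unique : {xs : List A} → Unique xs → ∀ n → Unique (vectors xs n)
vectors-unique u zero    = [] ∷ []
vectors-unique u (suc n) =
  Unique.cartesianProductWith⁺ _∷_ ∷-injective u (vectors-unique u n)

subsets : ∀ n → List (Subset n)
subsets = vectors (false ∷ true ∷ [])

∈-subsets : (s : Subset n) → s ∈ˡ subsets n
∈-subsets = ∈-vectors λ { false → here refl ; true → there (here refl) }

subsets-unique : ∀ n → Unique (subsets n)
subsets-unique = vectors-unique (((λ ()) ∷ []) ∷ [] ∷ [])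

subs : ∀ n → List (Sub n)
subs n = cartesianProductWith _,ₛ_ (subsets n) (vectors (subsets n) n)

∈-subs : (S : Sub n) → S ∈ˡ subs n
∈-subs (V ,ₛ M) =
  ∈-cartesianProductWith⁺ _,ₛ_ (∈-subsets V) (∈-vectors ∈-subsets M)

subs-unique : ∀ n → Unique (subs n)
subs-unique n = Unique.cartesianProductWith⁺ _,ₛ_ (λ { refl → refl , refl })
  (subsets-unique n) (vectors-unique (subsets-unique n) n)

anyFunction? : {P : Pred (Fin h → Fin n) ℓ} →
               (∀ {f g} → f ≗ g → P f → P g) → Decidable P → Dec (∃ P)
anyFunction? {h} {n} {P = P} resp P? =
  map′ (λ x → let (v , _ , p) = find x in lookup v , p)
       (λ (f , p) → lose (∈-vectors (∈-allFin {n}) (tabulate f))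
                         (resp (λ i → sym (lookup∘tabulate f i)) p))
       (Any.any? (λ v → P? (lookup v)) (vectors (allFin n) h))
  where
  open import Data.List.Membership.Propositional using (find; lose)
  import Data.List.Relation.Unary.Any as Any

isSubgraph? : (G : Graph n) → Decidable (IsSubgraph G)
isSubgraph? G S =
        all? (λ i → all? λ j → joined S i j Bool.≟ joined S j i)
  ×-dec all? (λ i → all? λ j → (joined S i j Bool.≟ true) →-dec
          ((adj G i j Bool.≟ true) ×-dec (i ∈? vertices S) ×-dec (j ∈? vertices S)))

isIsomorphism? : (H : Graph h) (S : Sub n) → Decidable (IsIsomorphism H S)
isIsomorphism? H S f =
        map′ (λ inj {i} {j} → inj i j) (λ inj i j → inj {i} {j})
             (all? λ i → all? λ j → (f i ≟ f j) →-dec (i ≟ j))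
  ×-dec all? (λ i → f i ∈? vertices S)
  ×-dec all? (λ v → (v ∈? vertices S) →-dec any? (λ i → f i ≟ v))
  ×-dec all? (λ i → all? λ j → adj H i j Bool.≟ joined S (f i) (f j))

isIsomorphism-resp-≗ : (H : Graph h) (S : Sub n) {f g : Fin h → Fin n} →
                       f ≗ g → IsIsomorphism H S f → IsIsomorphism H S g
isIsomorphism-resp-≗ H S f≗g (inj , into , onto , pres) =
    (λ {i} {j} gi≡gj → inj (trans (f≗g i) (trans gi≡gj (sym (f≗g j)))))
  , (λ i → subst (_∈ vertices S) (f≗g i) (into i))
  , (λ v v∈S → let (i , fi≡v) = onto v v∈S in i , trans (sym (f≗g i)) fi≡v)
  , (λ i j → trans (pres i j) (cong₂ (joined S) (f≗g i) (f≗g j)))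

isCopy? : (H : Graph h) (G : Graph n) → Decidable (IsCopy H G)
isCopy? H G S =
  isSubgraph? G S ×-dec anyFunction? (isIsomorphism-resp-≗ H S) (isIsomorphism? H S)

copies : Graph h → Graph n → List (Sub n)
copies {n = n} H G = filter (isCopy? H G) (subs n)

copies-unique : (H : Graph h) (G : Graph n) → Unique (copies H G)
copies-unique {n = n} H G = Unique.filter⁺ (isCopy? H G) (subs-unique n)

∈-copies : (H : Graph h) (G : Graph n) (S : Sub n) → S ∈ˡ copies H G ⇔ IsCopy H G S
∈-copies {n = n} H G S = mk⇔
  (λ S∈ → proj₂ (∈-filter⁻ (isCopy? H G) {xs = subs n} S∈))
  (∈-filter⁺ (isCopy? H G) (∈-subs S))

#copies : Graph h → Graph n → ℕ
#copies H G = length (copies H G)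

IsMaximum : Pred ℕ ℓ → Pred ℕ ℓ
IsMaximum P m = P m × (∀ k → P k → k ≤ m)

IsMinimum : Pred ℕ ℓ → Pred ℕ ℓ
IsMinimum P m = P m × (∀ k → P k → m ≤ k)

IsTuránNumber : ℕ → Graph h → ℕ → Set
IsTuránNumber n H =
  IsMaximum λ m → Σ (Graph n) λ G → size G ≡ m × (∀ S → ¬ IsCopy H G S)

IsMinimumCopies : Graph h → (n m : ℕ) → ℕ → Set
IsMinimumCopies H n m =
  IsMinimum λ c → Σ (Graph n) λ G → size G ≡ m × #copies H G ≡ c

{-# OPTIONS --safe #-}

-- A copy of B_p in a graph of order p + 2 is a pair of dominating vertices; in a graph of order
-- p + 3 it is a pair of hubs together with an omitted vertex x such that the hubs are adjacent
-- to everything except possibly x.  Count non-neighbours, each vertex being one of its own: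
-- the sum of these codegrees is n² - 2 size, so a graph with more edges than the Turán number has at
-- least three (order p + 2) or two (order p + 3) vertices of codegree 1.  In the latter
-- case, at size ex + 1, if there are exactly two such vertices u and v then all others have
-- codegree 2, and each of them forms one book with u and one with v; with the p + 1 books on
-- u and v this makes 3 (p + 1).  A third dominating vertex gives as many books directly.
-- Complements of matchings attain all the bounds.
module Submission where

open import Defs
import Algebra.Properties.Semiring.Sum as Sum-of
open import Data.Bool using (Bool; true; false; if_then_else_)
import Data.Bool.Properties as Bool
open import Data.Fin using (Fin; zero; suc; punchIn; punchOut; _<?_)
open import Data.Fin.Properties
  using (_≟_; any?; ¬∀⟶∃¬; <-cmp; injective⇒≤; suc-injective;
         punchIn-injective; punchInᵢ≢i; punchOut-injective; punchIn-punchOut)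
open import Data.Fin.Subset using (Subset; _∈_; _∉_; ⊤; ∁; ⁅_⁆)
open import Data.Fin.Subset.Properties
  using (_∈?_; ∈⊤; ⊆⊤; ⊆-antisym; x∈∁p⇒x∉p; x∉p⇒x∈∁p; x≢y⇒x∉⁅y⁆; x∉⁅y⁆⇒x≢y)
open import Data.List as List using (List; []; _∷_; _++_; length; map; filter; allFin; cartesianProduct)
import Data.List.Membership.DecPropositional as DecMembership
open import Data.List.Membership.Propositional using () renaming (_∈_ to _∈ˡ_; _∉_ to _∉ˡ_)
open import Data.List.Membership.Propositional.Properties
  using (∈-∃++; ∈-++⁻; ∈-++⁺ˡ; ∈-++⁺ʳ; ∈-allFin; ∈-filter⁺; ∈-filter⁻; ∈-map⁻; ∈-tabulate⁺; ∈-tabulate⁻)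
open import Data.List.Properties
  using (length-++; length-++-sucʳ; length-map; length-tabulate; filter-++)
open import Data.List.Relation.Unary.All as All using ([]; _∷_)
open import Data.List.Relation.Unary.AllPairs using ([]; _∷_)
open import Data.List.Relation.Unary.Any using (here; there)
open import Data.List.Relation.Unary.Unique.Propositional using (Unique)
import Data.List.Relation.Unary.Unique.Propositional.Properties as Unique
open import Data.Nat using (ℕ; zero; suc; _+_; _*_; _≤_; _<_; _≥_; _%_; _/_; z≤n; s≤s)
open import Data.Nat.DivMod using (m≡m%n+[m/n]*n)
import Data.Nat.Properties as ℕ
open import Data.Nat.Tactic.RingSolver using (solve-∀)
open import Data.Product using (∃; ∃₂; _×_; _,_; proj₁; proj₂)
open import Data.Sum as Sum using (_⊎_; inj₁; inj₂; [_,_]′)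
open import Data.Vec using (Vec; tabulate; lookup)
open import Data.Vec.Properties using (lookup∘tabulate; tabulate∘lookup; tabulate-cong)
open import Function using (Injective; _∘_; _⇔_; mk⇔; Equivalence)
open import Level using (0ℓ)
open import Relation.Binary using (tri<; tri≈; tri>)
open import Relation.Binary.PropositionalEquality
  using (_≡_; _≢_; refl; sym; trans; cong; cong₂; subst; ≢-sym; module ≡-Reasoning)
open import Relation.Nullary using (¬_; Dec; yes; no; does; contradiction)
open import Relation.Nullary.Decidable
  using (_×-dec_; _⊎-dec_; ¬?; dec-true; dec-false; decidable-stable)
open import Relation.Unary using (Pred; Decidable)

open Sum-of ℕ.+-*-semiring using (sum; ∑-distrib-+; ∑-comm; sum-cong-≗; *-distribˡ-sum)

private
  variable
    m n p : ℕ
    A B : Set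
    P : Set

-- Cardinality of finite lists and injections between finite sets.

unique⊆⇒length≤ : {xs ys : List A} → Unique xs → (∀ {x} → x ∈ˡ xs → x ∈ˡ ys) →
                  length xs ≤ length ys
unique⊆⇒length≤ {xs = []} _ _ = z≤n
-- Delete one occurrence of the head from `ys`; by uniqueness the tail survives this deletion.
unique⊆⇒length≤ {xs = x ∷ xs} (x∉xs ∷ u) xs⊆ys
  with as , bs , refl ← ∈-∃++ (xs⊆ys (here refl)) =
  subst (suc (length xs) ≤_) (sym (length-++-sucʳ as x bs))
    (s≤s (unique⊆⇒length≤ u λ y∈ → drop-x y∈ (∈-++⁻ as (xs⊆ys (there y∈)))))
  where
  drop-x : ∀ {y} → y ∈ˡ xs → y ∈ˡ as ⊎ y ∈ˡ x ∷ bs → y ∈ˡ as ++ bs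
  drop-x y∈ (inj₁ y∈as)         = ∈-++⁺ˡ y∈as
  drop-x y∈ (inj₂ (here refl))  = contradiction refl (All.lookup x∉xs y∈)
  drop-x y∈ (inj₂ (there y∈bs)) = ∈-++⁺ʳ as y∈bs

-- If every vertex occurred in `xs`, the duplicate-free list `allFin n` would be no longer than
-- `xs`.
fresh : (xs : List (Fin n)) → length xs < n → ∃ λ w → w ∉ˡ xs
fresh {n} xs xs<n with any? (λ w → ¬? (DecMembership._∈?_ _≟_ w xs))
... | yes found = found
... | no  none  = contradiction xs<n (ℕ.≤⇒≯ n≤xs)
  where
  n≤xs : n ≤ length xs
  n≤xs = subst (_≤ length xs) (length-tabulate {n = n} (λ i → i))
    (unique⊆⇒length≤ (Unique.allFin⁺ n)
      λ {w} _ → decidable-stable (DecMembership._∈?_ _≟_ w xs) λ w∉ → none (w , w∉))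

-- Punching out a missed value would inject `Fin (suc n)` into `Fin n`.
injective⇒onto : {f : Fin n → Fin n} → Injective _≡_ _≡_ f → ∀ v → ∃ λ i → f i ≡ v
injective⇒onto {suc n} {f} inj v with any? (λ i → f i ≟ v)
... | yes hit = hit
... | no miss = contradiction (injective⇒≤ avoid-injective) ℕ.1+n≰n
  where
  v≢ : ∀ i → v ≢ f i
  v≢ i v≡ = miss (i , sym v≡)
  avoid-injective : Injective _≡_ _≡_ (λ i → punchOut (v≢ i))
  avoid-injective eq = inj (punchOut-injective (v≢ _) (v≢ _) eq)

-- Cardinality yields a missed value `x`; after punching it out, an injective self-map remains,
-- which is onto. In order p + 3 this `x` is the vertex that a book omits.
injective⇒onto-except : {f : Fin n → Fin (suc n)} → Injective _≡_ _≡_ f →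
  ∃ λ x → (∀ i → f i ≢ x) × (∀ v → v ≢ x → ∃ λ i → f i ≡ v)
injective⇒onto-except {n} {f} inj
  with ¬∀⟶∃¬ (suc n) (λ v → ∃ λ i → f i ≡ v) (λ v → any? λ i → f i ≟ v) not-onto
  where
  not-onto : ¬ (∀ v → ∃ λ i → f i ≡ v)
  not-onto hit = ℕ.1+n≰n (injective⇒≤ {f = proj₁ ∘ hit}
    λ {v} {w} eq → trans (sym (proj₂ (hit v))) (trans (cong f eq) (proj₂ (hit w))))
... | x , miss = x , (λ i eq → miss (i , eq)) , onto
  where
  x≢ : ∀ i → x ≢ f i
  x≢ i eq = miss (i , sym eq)
  onto : ∀ v → v ≢ x → ∃ λ i → f i ≡ v
  onto v v≢x with injective⇒onto (λ eq → inj (punchOut-injective (x≢ _) (x≢ _) eq)) (punchOut (≢-sym v≢x))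
  ... | i , eq = i , punchOut-injective (x≢ i) (≢-sym v≢x) eq

-- Enumerations of a vertex set that start with two prescribed hubs.

Enumerates : (Fin m → Fin n) → Subset n → Set
Enumerates f V =
    Injective _≡_ _≡_ f
  × (∀ i → f i ∈ V)
  × (∀ v → v ∈ V → ∃ λ i → f i ≡ v)

module _ {a b : Fin (2 + p)} (a≢b : a ≢ b) where

  others : Fin p → Fin (2 + p)
  others i = punchIn a (punchIn (punchOut a≢b) i)

  others-injective : Injective _≡_ _≡_ others
  others-injective eq = punchIn-injective _ _ _ (punchIn-injective a _ _ eq)

  others≢a : ∀ i → others i ≢ a
  others≢a i = punchInᵢ≢i a _

  others≢b : ∀ i → others i ≢ b
  others≢b i eq = punchInᵢ≢i (punchOut a≢b) i
    (punchIn-injective a _ _ (trans eq (sym (punchIn-punchOut a≢b))))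

  -- The order agrees with the labelling of `Book p`, whose common edge joins vertices 0 and 1.
  hubsFirst : Fin (2 + p) → Fin (2 + p)
  hubsFirst zero          = a
  hubsFirst (suc zero)    = b
  hubsFirst (suc (suc i)) = others i

  hubsFirst-injective : Injective _≡_ _≡_ hubsFirst
  hubsFirst-injective {zero}        {zero}        eq = refl
  hubsFirst-injective {zero}        {suc zero}    eq = contradiction eq a≢b
  hubsFirst-injective {zero}        {suc (suc j)} eq = contradiction (sym eq) (others≢a j)
  hubsFirst-injective {suc zero}    {zero}        eq = contradiction (sym eq) a≢b
  hubsFirst-injective {suc zero}    {suc zero}    eq = refl
  hubsFirst-injective {suc zero}    {suc (suc j)} eq = contradiction (sym eq) (others≢b j)
  hubsFirst-injective {suc (suc i)} {zero}        eq = contradiction eq (others≢a i)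
  hubsFirst-injective {suc (suc i)} {suc zero}    eq = contradiction eq (others≢b i)
  hubsFirst-injective {suc (suc i)} {suc (suc j)} eq = cong (λ k → suc (suc k)) (others-injective eq)

  hubsFirst-enumerates : Enumerates hubsFirst ⊤
  hubsFirst-enumerates =
    hubsFirst-injective , (λ _ → ∈⊤) , λ v _ → injective⇒onto hubsFirst-injective v

∈-except : {x v : Fin n} → v ∈ ∁ ⁅ x ⁆ ⇔ v ≢ x
∈-except = mk⇔ (x∉⁅y⁆⇒x≢y ∘ x∈∁p⇒x∉p) (x∉p⇒x∈∁p ∘ x≢y⇒x∉⁅y⁆)

∈-except⁺ : {x v : Fin n} → v ≢ x → v ∈ ∁ ⁅ x ⁆
∈-except⁺ = Equivalence.from ∈-except

∈-except⁻ : {x v : Fin n} → v ∈ ∁ ⁅ x ⁆ → v ≢ x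
∈-except⁻ = Equivalence.to ∈-except

-- With `x` punched out only 2 + p vertices are left, so `hubsFirst` applies; `punchIn x` then
-- returns to the original labels.
enumerate-except : {a b x : Fin (3 + p)} → a ≢ b → a ≢ x → b ≢ x →
  ∃ λ (f : Fin (2 + p) → Fin (3 + p)) → Enumerates f (∁ ⁅ x ⁆) × f zero ≡ a × f (suc zero) ≡ b
enumerate-except {p} {a} {b} {x} a≢b a≢x b≢x =
    f
  , ( (λ eq → hubsFirst-injective a′≢b′ (punchIn-injective x _ _ eq))
    , (λ i → ∈-except⁺ (punchInᵢ≢i x _))
    , onto)
  , punchIn-punchOut x≢a , punchIn-punchOut x≢b
  where
  x≢a = ≢-sym a≢x
  x≢b = ≢-sym b≢x
  a′≢b′ : punchOut x≢a ≢ punchOut x≢b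
  a′≢b′ eq = a≢b (punchOut-injective x≢a x≢b eq)
  f : Fin (2 + p) → Fin (3 + p)
  f i = punchIn x (hubsFirst a′≢b′ i)
  onto : ∀ v → v ∈ ∁ ⁅ x ⁆ → ∃ λ i → f i ≡ v
  onto v v∈ =
    let x≢v = ≢-sym (∈-except⁻ v∈)
        (i , eq) = injective⇒onto (hubsFirst-injective a′≢b′) (punchOut x≢v)
    in i , trans (cong (punchIn x) eq) (punchIn-punchOut x≢v)

-- Books as concrete subgraphs, given by two hubs and a vertex set.

Touches : (a b i j : Fin n) → Set
Touches a b i j = (i ≡ a ⊎ i ≡ b) ⊎ (j ≡ a ⊎ j ≡ b)

-- Pages are not named: once both hubs lie in `V`, the remaining vertices of `V` are the apexes.
BookEdge : (a b : Fin n) → Subset n → (i j : Fin n) → Set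
BookEdge a b V i j = (i ∈ V × j ∈ V) × i ≢ j × Touches a b i j

bookEdge? : (a b : Fin n) (V : Subset n) (i j : Fin n) → Dec (BookEdge a b V i j)
bookEdge? a b V i j =
  ((i ∈? V) ×-dec (j ∈? V)) ×-dec ¬? (i ≟ j) ×-dec
  (((i ≟ a) ⊎-dec (i ≟ b)) ⊎-dec ((j ≟ a) ⊎-dec (j ≟ b)))

opaque
  -- Opaque, so that the tabulated matrix does not unfold in later goals; it is accessed through
  -- `vertices-book` and `joined-book`.
  book : (a b : Fin n) → Subset n → Sub n
  book a b V = V ,ₛ tabulate λ i → tabulate λ j → does (bookEdge? a b V i j)

  vertices-book : (a b : Fin n) (V : Subset n) → vertices (book a b V) ≡ V
  vertices-book a b V = refl

  joined-book : (a b : Fin n) (V : Subset n) → ∀ i j →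
                joined (book a b V) i j ≡ does (bookEdge? a b V i j)
  joined-book a b V i j = trans
    (cong (λ r → lookup r j) (lookup∘tabulate (λ i → tabulate λ j → does (bookEdge? a b V i j)) i))
    (lookup∘tabulate (λ j → does (bookEdge? a b V i j)) j)

does-true⇒ : {P : Set} (P? : Dec P) → does P? ≡ true → P
does-true⇒ (yes p) _ = p

≡-from-true⇔ : {x y : Bool} → (x ≡ true → y ≡ true) → (y ≡ true → x ≡ true) → x ≡ y
≡-from-true⇔ {false} {false} f g = refl
≡-from-true⇔ {false} {true}  f g = g refl
≡-from-true⇔ {true}  {y}     f g = sym (f refl)

joined-book⁻ : (a b : Fin n) (V : Subset n) → ∀ {i j} →
               joined (book a b V) i j ≡ true → BookEdge a b V i j
joined-book⁻ a b V {i} {j} eq =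
  does-true⇒ (bookEdge? a b V i j) (trans (sym (joined-book a b V i j)) eq)

joined-book⁺ : (a b : Fin n) (V : Subset n) → ∀ {i j} →
               BookEdge a b V i j → joined (book a b V) i j ≡ true
joined-book⁺ a b V {i} {j} e =
  trans (joined-book a b V i j) (dec-true (bookEdge? a b V i j) e)

Sub-ext : {V : Subset n} {S T : Sub n} → vertices S ≡ V → vertices T ≡ V →
          (∀ i j → joined S i j ≡ joined T i j) → S ≡ T
Sub-ext {S = V ,ₛ M} {T = _ ,ₛ N} refl refl eq = cong (V ,ₛ_) (lookup-ext λ i → lookup-ext (eq i))
  where
  lookup-ext : {B : Set} {k : ℕ} {xs ys : Vec B k} →
               (∀ i → lookup xs i ≡ lookup ys i) → xs ≡ ys
  lookup-ext eq = trans (sym (tabulate∘lookup _)) (trans (tabulate-cong eq) (tabulate∘lookup _))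

touches-sym : {a b i j : Fin n} → Touches a b i j → Touches a b j i
touches-sym = Sum.swap

-- Lets a list of books contain each unordered pair of hubs once.
book-comm : (a b : Fin n) (V : Subset n) → book a b V ≡ book b a V
book-comm a b V = Sub-ext (vertices-book a b V) (vertices-book b a V) λ i j → ≡-from-true⇔
  (λ e → joined-book⁺ b a V (swapHubs (joined-book⁻ a b V e)))
  (λ e → joined-book⁺ a b V (swapHubs (joined-book⁻ b a V e)))
  where
  swapHubs : ∀ {a b i j} → BookEdge a b V i j → BookEdge b a V i j
  swapHubs (ij∈V , i≢j , t) = ij∈V , i≢j , Sum.map Sum.swap Sum.swap t

-- Together with `adj-Book⁺` this brings adjacency in `Book p` into the shape of `BookEdge`, which
-- can be carried along an injection.
adj-Book⁻ : ∀ {i j} → adj (Book p) i j ≡ true → i ≢ j × Touches zero (suc zero) i j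
adj-Book⁻ {i = zero}        {suc _}       _ = (λ ()) , inj₁ (inj₁ refl)
adj-Book⁻ {i = suc _}       {zero}        _ = (λ ()) , inj₂ (inj₁ refl)
adj-Book⁻ {i = suc zero}    {suc (suc _)} _ = (λ ()) , inj₁ (inj₂ refl)
adj-Book⁻ {i = suc (suc _)} {suc zero}    _ = (λ ()) , inj₂ (inj₂ refl)

adj-Book⁺ : ∀ {i j} → i ≢ j → Touches zero (suc zero) i j → adj (Book p) i j ≡ true
adj-Book⁺ {i = zero}        {zero}        i≢j _ = contradiction refl i≢j
adj-Book⁺ {i = zero}        {suc _}       _   _ = refl
adj-Book⁺ {i = suc _}       {zero}        _   _ = refl
adj-Book⁺ {i = suc zero}    {suc zero}    i≢j _ = contradiction refl i≢j
adj-Book⁺ {i = suc zero}    {suc (suc _)} _   _ = refl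
adj-Book⁺ {i = suc (suc _)} {suc zero}    _   _ = refl
adj-Book⁺ {i = suc (suc _)} {suc (suc _)} _ (inj₁ (inj₁ ()))
adj-Book⁺ {i = suc (suc _)} {suc (suc _)} _ (inj₁ (inj₂ ()))
adj-Book⁺ {i = suc (suc _)} {suc (suc _)} _ (inj₂ (inj₁ ()))
adj-Book⁺ {i = suc (suc _)} {suc (suc _)} _ (inj₂ (inj₂ ()))

-- Injectivity of `f` both preserves and reflects distinctness and incidence with a hub.
adj-Book≡joined-book : {f : Fin (2 + p) → Fin n} {V : Subset n} → Enumerates f V → ∀ i j →
  adj (Book p) i j ≡ joined (book (f zero) (f (suc zero)) V) (f i) (f j)
adj-Book≡joined-book {f = f} {V} (inj , into , _) i j = ≡-from-true⇔
  (λ e → let (i≢j , t) = adj-Book⁻ e in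
    joined-book⁺ _ _ V ((into i , into j) , (λ eq → i≢j (inj eq)) , transport t))
  (λ e → let (_ , fi≢fj , t) = joined-book⁻ _ _ V e in
    adj-Book⁺ (λ eq → fi≢fj (cong f eq)) (reflect t))
  where
  transport : Touches zero (suc zero) i j → Touches (f zero) (f (suc zero)) (f i) (f j)
  transport = Sum.map (Sum.map (cong f) (cong f)) (Sum.map (cong f) (cong f))
  reflect : Touches (f zero) (f (suc zero)) (f i) (f j) → Touches zero (suc zero) i j
  reflect = Sum.map (Sum.map inj inj) (Sum.map inj inj)

-- Copies of a book correspond to pairs of hubs.

FullOn : Graph n → Subset n → Fin n → Set
FullOn G V a = a ∈ V × (∀ v → v ∈ V → v ≢ a → adj G a v ≡ true)

IsBook : Graph n → (a b : Fin n) → Subset n → Set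
IsBook G a b V = a ≢ b × FullOn G V a × FullOn G V b

opaque
  -- Here `vertices (book a b V)` has to reduce to `V` for `IsCopy` to match.
  unfolding book

  book-isCopy : (G : Graph n) {a b : Fin n} {V : Subset n} → IsBook G a b V →
    (∃ λ (f : Fin (2 + p) → Fin n) → Enumerates f V × f zero ≡ a × f (suc zero) ≡ b) →
    IsCopy (Book p) G (book a b V)
  book-isCopy {n} G {a} {b} {V} (a≢b , (_ , fullᵃ) , (_ , fullᵇ)) (f , enum@(inj , into , onto) , refl , refl) =
    (joined-sym , λ i j e → let ((i∈ , j∈) , i≢j , t) = joined-book⁻ a b V e in
                            edge i∈ j∈ i≢j t , i∈ , j∈)
    , f , inj , into , onto , adj-Book≡joined-book enum
    where
    flip-edge : ∀ i j → BookEdge a b V i j → BookEdge a b V j i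
    flip-edge i j ((i∈ , j∈) , i≢j , t) = (j∈ , i∈) , ≢-sym i≢j , touches-sym t
    joined-sym : ∀ i j → joined (book a b V) i j ≡ joined (book a b V) j i
    joined-sym i j = ≡-from-true⇔
      (λ e → joined-book⁺ a b V (flip-edge i j (joined-book⁻ a b V e)))
      (λ e → joined-book⁺ a b V (flip-edge j i (joined-book⁻ a b V e)))
    edge : ∀ {i j} → i ∈ V → j ∈ V → i ≢ j → Touches a b i j → adj G i j ≡ true
    edge i∈ j∈ i≢j (inj₁ (inj₁ refl)) = fullᵃ _ j∈ (≢-sym i≢j)
    edge i∈ j∈ i≢j (inj₁ (inj₂ refl)) = fullᵇ _ j∈ (≢-sym i≢j)
    edge i∈ j∈ i≢j (inj₂ (inj₁ refl)) = trans (symmetric G _ _) (fullᵃ _ i∈ i≢j)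
    edge i∈ j∈ i≢j (inj₂ (inj₂ refl)) = trans (symmetric G _ _) (fullᵇ _ i∈ i≢j)

-- The converse of `book-isCopy`. Vertices of the copy are pulled back along `f`, so its matrix is
-- that of the book on the images of 0 and 1; the spokes of `Book p` make these images full.
copy⇒book : (G : Graph n) (S : Sub n) → IsCopy (Book p) G S →
  ∃ λ (f : Fin (2 + p) → Fin n) → Enumerates f (vertices S)
    × IsBook G (f zero) (f (suc zero)) (vertices S)
    × S ≡ book (f zero) (f (suc zero)) (vertices S)
copy⇒book {n} {p} G S ((_ , sub) , f , inj , into , onto , pres) = f , enum
  , ((λ eq → contradiction (inj eq) λ ()) , full zero spoke₀ , full (suc zero) spoke₁)
  , Sub-ext refl (vertices-book a b V) λ i j → ≡-from-true⇔
      (λ e → let (_ , i∈ , j∈) = sub i j e in trans (sym (agree i∈ j∈)) e)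
      (λ e → let ((i∈ , j∈) , _) = joined-book⁻ a b V e in trans (agree i∈ j∈) e)
  where
  V = vertices S
  enum : Enumerates f V
  enum = inj , into , onto
  a = f zero
  b = f (suc zero)
  agree : ∀ {i j} → i ∈ V → j ∈ V → joined S i j ≡ joined (book a b V) i j
  agree i∈ j∈ with onto _ i∈ | onto _ j∈
  ... | k , refl | l , refl = trans (sym (pres k l)) (adj-Book≡joined-book enum k l)
  full : ∀ h → (∀ k → k ≢ h → adj (Book p) h k ≡ true) → FullOn G V (f h)
  full h spoke = into h , λ v v∈ v≢ → let (k , eq) = onto v v∈ in
    subst (λ v → adj G (f h) v ≡ true) eq
      (proj₁ (sub _ _ (trans (sym (pres h k)) (spoke k λ { refl → v≢ (sym eq) }))))
  spoke₀ : ∀ k → k ≢ zero → adj (Book p) zero k ≡ true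
  spoke₀ k k≢ = adj-Book⁺ (≢-sym k≢) (inj₁ (inj₁ refl))
  spoke₁ : ∀ k → k ≢ suc zero → adj (Book p) (suc zero) k ≡ true
  spoke₁ k k≢ = adj-Book⁺ (≢-sym k≢) (inj₁ (inj₂ refl))

-- An injection between sets of equal size is onto, so the copy spans the graph.
copy⇒book₂ : (G : Graph (2 + p)) (S : Sub (2 + p)) → IsCopy (Book p) G S →
             ∃₂ λ a b → IsBook G a b ⊤ × S ≡ book a b ⊤
copy⇒book₂ {p} G S c =
  let (f , (inj , into , _) , isBook , S≡) = copy⇒book G S c
      a = f zero
      b = f (suc zero)
      V≡ : vertices S ≡ ⊤
      V≡ = ⊆-antisym ⊆⊤ λ {v} _ →
        let (i , eq) = injective⇒onto {f = f} inj v in subst (_∈ vertices S) eq (into i)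
  in a , b , subst (IsBook G a b) V≡ isBook , trans S≡ (cong (book a b) V≡)

-- The enumeration of the copy misses exactly one vertex of the graph.
copy⇒book₃ : (G : Graph (3 + p)) (S : Sub (3 + p)) → IsCopy (Book p) G S →
             ∃ λ a → ∃₂ λ b x → IsBook G a b (∁ ⁅ x ⁆) × S ≡ book a b (∁ ⁅ x ⁆)
copy⇒book₃ G S c =
  let (f , (inj , into , onto) , isBook , S≡) = copy⇒book G S c
      (x , miss , hit) = injective⇒onto-except {f = f} inj
      a = f zero
      b = f (suc zero)
      V≡ : vertices S ≡ ∁ ⁅ x ⁆
      V≡ = ⊆-antisym
        (λ {v} v∈ → ∈-except⁺ λ v≡x → let (i , eq) = onto v v∈ in miss i (trans eq v≡x))
        (λ {v} v∈ → let (i , eq) = hit v (∈-except⁻ v∈) in subst (_∈ vertices S) eq (into i))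
  in a , b , x , subst (IsBook G a b) V≡ isBook , trans S≡ (cong (book a b) V≡)

book-isCopy₂ : (G : Graph (2 + p)) {a b : Fin (2 + p)} → IsBook G a b ⊤ →
               IsCopy (Book p) G (book a b ⊤)
book-isCopy₂ G isBook@(a≢b , _) =
  book-isCopy G isBook (hubsFirst a≢b , hubsFirst-enumerates a≢b , refl , refl)

book-isCopy₃ : (G : Graph (3 + p)) {a b x : Fin (3 + p)} → IsBook G a b (∁ ⁅ x ⁆) →
               IsCopy (Book p) G (book a b (∁ ⁅ x ⁆))
book-isCopy₃ G isBook@(a≢b , (a∈ , _) , (b∈ , _)) =
  book-isCopy G isBook (enumerate-except a≢b (∈-except⁻ a∈) (∈-except⁻ b∈))

-- A vertex other than the hubs meets only the hubs, so a fourth vertex tells it apart from a hub.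
book-hubs : {a b a′ b′ c : Fin n} {V V′ : Subset n} →
  c ≡ a ⊎ c ≡ b → c ∈ V → (∃ λ w → w ∈ V × w ∉ˡ (c ∷ a′ ∷ b′ ∷ [])) →
  book a b V ≡ book a′ b′ V′ → c ≡ a′ ⊎ c ≡ b′
book-hubs {a = a} {b} {a′} {b′} {c} {V} {V′} hub c∈V (w , w∈V , w∉) eq
  with joined-book⁻ a′ b′ V′ (subst (λ S → joined S c w ≡ true) eq
         (joined-book⁺ a b V ((c∈V , w∈V) , (λ c≡w → w∉ (here (sym c≡w))) , inj₁ hub)))
... | _ , _ , inj₁ hub′        = hub′
... | _ , _ , inj₂ (inj₁ w≡a′) = contradiction (there (here w≡a′)) w∉
... | _ , _ , inj₂ (inj₂ w≡b′) = contradiction (there (there (here w≡b′))) w∉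

-- The bound 4 leaves room for a vertex besides `c`, `a′` and `b′`.
book-hubs₂ : {a b a′ b′ c : Fin n} → 4 ≤ n → c ≡ a ⊎ c ≡ b →
  book a b ⊤ ≡ book a′ b′ ⊤ → c ≡ a′ ⊎ c ≡ b′
book-hubs₂ {a′ = a′} {b′} {c} 4≤n hub =
  let (w , w∉) = fresh (c ∷ a′ ∷ b′ ∷ []) 4≤n in book-hubs hub ∈⊤ (w , ∈⊤ , w∉)

-- The bound is one higher than for `book-hubs₂` because the fresh vertex must also avoid the
-- omitted `x`.
book-hubs₃ : {a b a′ b′ c x x′ : Fin n} → 5 ≤ n → c ≡ a ⊎ c ≡ b → c ≢ x →
  book a b (∁ ⁅ x ⁆) ≡ book a′ b′ (∁ ⁅ x′ ⁆) → c ≡ a′ ⊎ c ≡ b′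
book-hubs₃ {a′ = a′} {b′} {c} {x} 5≤n hub c≢x =
  let (w , w∉) = fresh (x ∷ c ∷ a′ ∷ b′ ∷ []) 5≤n
  in book-hubs hub (∈-except⁺ c≢x) (w , ∈-except⁺ (w∉ ∘ here) , w∉ ∘ there)

except-injective : {x y : Fin n} → ∁ ⁅ x ⁆ ≡ ∁ ⁅ y ⁆ → x ≡ y
except-injective {x = x} {y} eq = decidable-stable (x ≟ y) λ x≢y →
  ∈-except⁻ (subst (x ∈_) (sym eq) (∈-except⁺ x≢y)) refl

-- Sizes and codegrees as sums of indicators, and the handshake identity.

indicator : Dec P → ℕ
indicator d = if does d then 1 else 0

sum-mono : (f g : Fin n → ℕ) → (∀ i → f i ≤ g i) → sum f ≤ sum g
sum-mono {zero}  f g f≤g = z≤n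
sum-mono {suc n} f g f≤g = ℕ.+-mono-≤ (f≤g zero) (sum-mono (f ∘ suc) (g ∘ suc) (f≤g ∘ suc))

sum-const : ∀ n c → sum {n} (λ _ → c) ≡ n * c
sum-const zero    c = refl
sum-const (suc n) c = cong (c +_) (sum-const n c)

length-filter-tabulate : {Q : Pred A 0ℓ} (Q? : Decidable Q) (f : Fin n → A) →
  length (filter Q? (List.tabulate f)) ≡ sum (λ i → indicator (Q? (f i)))
length-filter-tabulate {n = zero}  Q? f = refl
length-filter-tabulate {n = suc n} Q? f with does (Q? (f zero))
... | true  = cong suc (length-filter-tabulate Q? (f ∘ suc))
... | false = length-filter-tabulate Q? (f ∘ suc)

length-filter-map : {Q : Pred B 0ℓ} (Q? : Decidable Q) (f : A → B) (xs : List A) →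
  length (filter Q? (map f xs)) ≡ length (filter (Q? ∘ f) xs)
length-filter-map Q? f []       = refl
length-filter-map Q? f (x ∷ xs) with does (Q? (f x))
... | true  = cong suc (length-filter-map Q? f xs)
... | false = length-filter-map Q? f xs

length-filter-cartesianProduct : {Q : Pred (A × B) 0ℓ} (Q? : Decidable Q) (f : Fin m → A) (ys : List B) →
  length (filter Q? (cartesianProduct (List.tabulate f) ys)) ≡
  sum (λ i → length (filter (λ y → Q? (f i , y)) ys))
length-filter-cartesianProduct {m = zero}  Q? f ys = refl
length-filter-cartesianProduct {m = suc m} Q? f ys = begin
  length (filter Q? (row ++ rest))
    ≡⟨ cong length (filter-++ Q? row rest) ⟩
  length (filter Q? row ++ filter Q? rest)
    ≡⟨ length-++ (filter Q? row) ⟩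
  length (filter Q? row) + length (filter Q? rest)
    ≡⟨ cong₂ _+_ (length-filter-map Q? (f zero ,_) ys) (length-filter-cartesianProduct Q? (f ∘ suc) ys) ⟩
  sum (λ i → length (filter (λ y → Q? (f i , y)) ys)) ∎
  where
  open ≡-Reasoning
  row  = map (f zero ,_) ys
  rest = cartesianProduct (List.tabulate (f ∘ suc)) ys

-- A vertex counts as its own non-neighbour.
nonNeighbours : Graph n → Fin n → List (Fin n)
nonNeighbours {n} G i = filter (λ j → adj G i j Bool.≟ false) (allFin n)

codegree : Graph n → Fin n → ℕ
codegree G i = length (nonNeighbours G i)

nonEdge edge< : (G : Graph n) → Fin n → Fin n → ℕ
nonEdge G i j = indicator (adj G i j Bool.≟ false)
edge<   G i j = indicator ((i <? j) ×-dec (adj G i j Bool.≟ true))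

codegree-sum : (G : Graph n) (i : Fin n) → codegree G i ≡ sum (nonEdge G i)
codegree-sum G i = length-filter-tabulate (λ j → adj G i j Bool.≟ false) (λ j → j)

size-sum : (G : Graph n) → size G ≡ sum (λ i → sum (edge< G i))
size-sum {n} G = trans
  (length-filter-cartesianProduct (λ (i , j) → (i <? j) ×-dec (adj G i j Bool.≟ true)) (λ i → i) (allFin n))
  (sum-cong-≗ λ i → length-filter-tabulate (λ j → (i <? j) ×-dec (adj G i j Bool.≟ true)) (λ j → j))

-- An ordered pair is an edge listed forwards, an edge listed backwards, or non-adjacent; the
-- diagonal falls under the last case.
edge-trichotomy : (G : Graph n) → ∀ i j → edge< G i j + edge< G j i + nonEdge G i j ≡ 1
edge-trichotomy G i j with <-cmp i j
... | tri≈ i≮j refl _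
  rewrite dec-false (i <? i) i≮j | irreflexive G i = refl
... | tri< i<j _ j≮i
  rewrite dec-true (i <? j) i<j | dec-false (j <? i) j≮i with adj G i j
...   | true  = refl
...   | false = refl
edge-trichotomy G i j | tri> i≮j _ j<i
  rewrite dec-false (i <? j) i≮j | dec-true (j <? i) j<i | symmetric G j i with adj G i j
...   | true  = refl
...   | false = refl

-- Sum `edge-trichotomy` over all ordered pairs. The second `size G` is transposed by `∑-comm` to
-- account for the edges listed backwards.
handshake : (G : Graph n) → size G + size G + sum (codegree G) ≡ n * n
handshake {n} G = begin
  size G + size G + sum (codegree G)
    ≡⟨ cong₂ _+_ (cong₂ _+_ (size-sum G) (trans (size-sum G) (∑-comm (edge< G))))
                 (sum-cong-≗ (codegree-sum G)) ⟩
  sum (λ i → sum (edge< G i)) + sum (λ i → sum (λ j → edge< G j i)) + sum (λ i → sum (nonEdge G i))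
    ≡⟨ cong (_+ sum (λ i → sum (nonEdge G i))) (∑-distrib-+ (λ i → sum (edge< G i)) (λ i → sum (λ j → edge< G j i))) ⟨
  sum (λ i → sum (edge< G i) + sum (λ j → edge< G j i)) + sum (λ i → sum (nonEdge G i))
    ≡⟨ ∑-distrib-+ (λ i → sum (edge< G i) + sum (λ j → edge< G j i)) (λ i → sum (nonEdge G i)) ⟨
  sum (λ i → sum (edge< G i) + sum (λ j → edge< G j i) + sum (nonEdge G i))
    ≡⟨ sum-cong-≗ row ⟩
  sum {n} (λ _ → n)
    ≡⟨ sum-const n n ⟩
  n * n ∎
  where
  open ≡-Reasoning
  row : ∀ i → sum (edge< G i) + sum (λ j → edge< G j i) + sum (nonEdge G i) ≡ n
  row i = begin
    sum (edge< G i) + sum (λ j → edge< G j i) + sum (nonEdge G i)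
      ≡⟨ cong (_+ sum (nonEdge G i)) (∑-distrib-+ (edge< G i) (λ j → edge< G j i)) ⟨
    sum (λ j → edge< G i j + edge< G j i) + sum (nonEdge G i)
      ≡⟨ ∑-distrib-+ (λ j → edge< G i j + edge< G j i) (nonEdge G i) ⟨
    sum (λ j → edge< G i j + edge< G j i + nonEdge G i j)
      ≡⟨ sum-cong-≗ (edge-trichotomy G i) ⟩
    sum {n} (λ _ → 1)
      ≡⟨ trans (sum-const n 1) (ℕ.*-identityʳ n) ⟩
    n ∎

-- Vertices of codegree 1 and 2.

module _ (G : Graph n) where

  i∈nonNeighbours : ∀ i → i ∈ˡ nonNeighbours G i
  i∈nonNeighbours i = ∈-filter⁺ (λ j → adj G i j Bool.≟ false) (∈-allFin i) (irreflexive G i)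

  nonNeighbours-unique : ∀ i → Unique (nonNeighbours G i)
  nonNeighbours-unique i = Unique.filter⁺ (λ j → adj G i j Bool.≟ false) (Unique.allFin⁺ n)

  adj-outside-nonNeighbours : ∀ {i j} → j ∉ˡ nonNeighbours G i → adj G i j ≡ true
  adj-outside-nonNeighbours {i} {j} j∉ with adj G i j in eq
  ... | true  = refl
  ... | false = contradiction (∈-filter⁺ (λ j → adj G i j Bool.≟ false) (∈-allFin j) eq) j∉

  codegree≥1 : ∀ i → 1 ≤ codegree G i
  codegree≥1 i with nonNeighbours G i | i∈nonNeighbours i
  ... | _ ∷ _ | _ = s≤s z≤n

  codegree1⇒adj : ∀ {u} → codegree G u ≡ 1 → ∀ v → v ≢ u → adj G u v ≡ true
  codegree1⇒adj {u} eq v v≢u = adj-outside-nonNeighbours (go (nonNeighbours G u) eq (i∈nonNeighbours u))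
    where
    go : ∀ xs → length xs ≡ 1 → u ∈ˡ xs → v ∉ˡ xs
    go (_ ∷ []) _ (here refl) (here refl) = v≢u refl

  -- Of the two distinct non-neighbours one is `u` itself, in either position of the list, and the
  -- other is `x`.
  codegree2⇒adj : ∀ {u} → codegree G u ≡ 2 →
    ∃ λ x → x ≢ u × adj G u x ≡ false × (∀ v → v ≢ u → v ≢ x → adj G u v ≡ true)
  codegree2⇒adj {u} eq with go (nonNeighbours G u) eq (nonNeighbours-unique u) (i∈nonNeighbours u)
    where
    go : ∀ xs → length xs ≡ 2 → Unique xs → u ∈ˡ xs →
         ∃ λ x → x ≢ u × x ∈ˡ xs × (∀ v → v ≢ u → v ≢ x → v ∉ˡ xs)
    go (_ ∷ x ∷ []) _ ((u≢x ∷ []) ∷ _) (here refl) = x , ≢-sym u≢x , there (here refl) ,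
      λ { v v≢u v≢x (here v≡u) → v≢u v≡u ; v v≢u v≢x (there (here v≡x)) → v≢x v≡x }
    go (x ∷ _ ∷ []) _ ((x≢u ∷ []) ∷ _) (there (here refl)) = x , x≢u , here refl ,
      λ { v v≢u v≢x (here v≡x) → v≢x v≡x ; v v≢u v≢x (there (here v≡u)) → v≢u v≡u }
  ... | x , x≢u , x∈ , out = x , x≢u
      , proj₂ (∈-filter⁻ (λ j → adj G u j Bool.≟ false) {xs = allFin n} x∈)
      , λ v v≢u v≢x → adj-outside-nonNeighbours (out v v≢u v≢x)

  ofCodegree : ℕ → List (Fin n)
  ofCodegree k = filter (λ i → codegree G i ℕ.≟ k) (allFin n)

  ofCodegree-unique : ∀ k → Unique (ofCodegree k)
  ofCodegree-unique k = Unique.filter⁺ (λ i → codegree G i ℕ.≟ k) (Unique.allFin⁺ n)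

  ∈-ofCodegree⁻ : ∀ {k i} → i ∈ˡ ofCodegree k → codegree G i ≡ k
  ∈-ofCodegree⁻ {k} i∈ = proj₂ (∈-filter⁻ (λ i → codegree G i ℕ.≟ k) {xs = allFin n} i∈)

  private
    hasCodegree : ℕ → Fin n → ℕ
    hasCodegree k i = indicator (codegree G i ℕ.≟ k)

    length-ofCodegree : ∀ k → length (ofCodegree k) ≡ sum (hasCodegree k)
    length-ofCodegree k = length-filter-tabulate (λ i → codegree G i ℕ.≟ k) (λ i → i)

  -- No codegree is below 1, so the indicator of codegree 1 makes up the whole deficit to 2 at each
  -- vertex.
  twice-order≤ : n * 2 ≤ sum (codegree G) + length (ofCodegree 1)
  twice-order≤ = begin
    n * 2                                       ≡⟨ sum-const n 2 ⟨
    sum {n} (λ _ → 2)                           ≤⟨ sum-mono _ _ (λ i → pointwise (codegree G i) (codegree≥1 i)) ⟩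
    sum (λ i → codegree G i + hasCodegree 1 i)  ≡⟨ ∑-distrib-+ (codegree G) (hasCodegree 1) ⟩
    sum (codegree G) + sum (hasCodegree 1)      ≡⟨ cong (sum (codegree G) +_) (length-ofCodegree 1) ⟨
    sum (codegree G) + length (ofCodegree 1)    ∎
    where
    open ℕ.≤-Reasoning
    pointwise : ∀ d → 1 ≤ d → 2 ≤ d + indicator (d ℕ.≟ 1)
    pointwise (suc zero)    _ = s≤s (s≤s z≤n)
    pointwise (suc (suc d)) _ = s≤s (s≤s z≤n)

  -- The deficit to 3 is two at codegree 1, hence the doubled count, and one at codegree 2.
  thrice-order≤ : n * 3 ≤ sum (codegree G) + (length (ofCodegree 1) + length (ofCodegree 1)) + length (ofCodegree 2)
  thrice-order≤ = begin
    n * 3                 ≡⟨ sum-const n 3 ⟨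
    sum {n} (λ _ → 3)     ≤⟨ sum-mono _ _ (λ i → pointwise (codegree G i) (codegree≥1 i)) ⟩
    sum (λ i → codegree G i + (hasCodegree 1 i + hasCodegree 1 i) + hasCodegree 2 i)
      ≡⟨ ∑-distrib-+ (λ i → codegree G i + (hasCodegree 1 i + hasCodegree 1 i)) (hasCodegree 2) ⟩
    sum (λ i → codegree G i + (hasCodegree 1 i + hasCodegree 1 i)) + sum (hasCodegree 2)
      ≡⟨ cong (_+ sum (hasCodegree 2)) (∑-distrib-+ (codegree G) (λ i → hasCodegree 1 i + hasCodegree 1 i)) ⟩
    sum (codegree G) + sum (λ i → hasCodegree 1 i + hasCodegree 1 i) + sum (hasCodegree 2)
      ≡⟨ cong (λ s → sum (codegree G) + s + sum (hasCodegree 2)) (∑-distrib-+ (hasCodegree 1) (hasCodegree 1)) ⟩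
    sum (codegree G) + (sum (hasCodegree 1) + sum (hasCodegree 1)) + sum (hasCodegree 2)
      ≡⟨ cong₂ (λ d e → sum (codegree G) + (d + d) + e) (length-ofCodegree 1) (length-ofCodegree 2) ⟨
    sum (codegree G) + (length (ofCodegree 1) + length (ofCodegree 1)) + length (ofCodegree 2) ∎
    where
    open ℕ.≤-Reasoning
    pointwise : ∀ d → 1 ≤ d → 3 ≤ d + (indicator (d ℕ.≟ 1) + indicator (d ℕ.≟ 1)) + indicator (d ℕ.≟ 2)
    pointwise (suc zero)          _ = s≤s (s≤s (s≤s z≤n))
    pointwise (suc (suc zero))    _ = s≤s (s≤s (s≤s z≤n))
    pointwise (suc (suc (suc d))) _ = s≤s (s≤s (s≤s z≤n))

-- Complements of matchings.

module _ (π : Fin n → Fin n) (involutive : ∀ i → π (π i) ≡ i) where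

  Unmatched : Fin n → Fin n → Set
  Unmatched i j = i ≢ j × π i ≢ j

  unmatched? : ∀ i j → Dec (Unmatched i j)
  unmatched? i j = ¬? (i ≟ j) ×-dec ¬? (π i ≟ j)

  -- The involution encodes the matching: its 2-cycles are the matching edges and its fixed points
  -- the unmatched vertices.
  matchingComplement : Graph n
  matchingComplement = record
    { adj         = λ i j → does (unmatched? i j)
    ; symmetric   = λ i j → ≡-from-true⇔
        (λ e → dec-true (unmatched? j i) (flip (does-true⇒ (unmatched? i j) e)))
        (λ e → dec-true (unmatched? i j) (flip (does-true⇒ (unmatched? j i) e)))
    ; irreflexive = λ i → dec-false (unmatched? i i) λ (i≢i , _) → i≢i refl
    }
    where
    flip : ∀ {i j} → Unmatched i j → Unmatched j i
    flip (i≢j , πi≢j) = ≢-sym i≢j , λ πj≡i → πi≢j (trans (cong π (sym πj≡i)) (involutive _))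

  moved : Fin n → ℕ
  moved i = indicator (¬? (π i ≟ i))

  -- The non-neighbours of `i` are `i` and `π i`; the factor `moved i` prevents a fixed point from
  -- being counted twice.
  nonEdge-matchingComplement : ∀ i j →
    nonEdge matchingComplement i j ≡ indicator (i ≟ j) + moved i * indicator (π i ≟ j)
  nonEdge-matchingComplement i j with i ≟ j | π i ≟ j | π i ≟ i
  ... | yes refl | yes _   | yes _   = refl
  ... | yes refl | no _    | yes _   = refl
  ... | yes refl | no _    | no _    = refl
  ... | yes refl | yes e   | no ¬e   = contradiction e ¬e
  ... | no i≢j   | yes e   | yes e′  = contradiction (trans (sym e′) e) i≢j
  ... | no _     | yes _   | no _    = refl
  ... | no _     | no _    | yes _   = refl
  ... | no _     | no _    | no _    = refl

sum-indicator-≟ : (i : Fin n) → sum (λ j → indicator (i ≟ j)) ≡ 1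
sum-indicator-≟ {suc n} zero    = cong suc (trans (sum-const n 0) (ℕ.*-zeroʳ n))
sum-indicator-≟ {suc n} (suc i) = sum-indicator-≟ i

module _ (π : Fin n → Fin n) (involutive : ∀ i → π (π i) ≡ i) where

  private
    G = matchingComplement π involutive

  codegree-matchingComplement : ∀ i → codegree G i ≡ 1 + moved π involutive i
  codegree-matchingComplement i = begin
    codegree G i
      ≡⟨ codegree-sum G i ⟩
    sum (nonEdge G i)
      ≡⟨ sum-cong-≗ (nonEdge-matchingComplement π involutive i) ⟩
    sum (λ j → indicator (i ≟ j) + c * indicator (π i ≟ j))
      ≡⟨ ∑-distrib-+ (λ j → indicator (i ≟ j)) (λ j → c * indicator (π i ≟ j)) ⟩
    sum (λ j → indicator (i ≟ j)) + sum (λ j → c * indicator (π i ≟ j))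
      ≡⟨ cong₂ _+_ (sum-indicator-≟ i) (sym (*-distribˡ-sum c (λ j → indicator (π i ≟ j)))) ⟩
    1 + c * sum (λ j → indicator (π i ≟ j))
      ≡⟨ cong (λ s → 1 + c * s) (sum-indicator-≟ (π i)) ⟩
    1 + c * 1
      ≡⟨ cong suc (ℕ.*-identityʳ c) ⟩
    1 + c ∎
    where
    open ≡-Reasoning
    c = moved π involutive i

  size-matchingComplement : size G + size G + (n + sum (moved π involutive)) ≡ n * n
  size-matchingComplement = trans (cong (size G + size G +_) (sym codegree-total)) (handshake G)
    where
    open ≡-Reasoning
    codegree-total : sum (codegree G) ≡ n + sum (moved π involutive)
    codegree-total = begin
      sum (codegree G)                          ≡⟨ sum-cong-≗ codegree-matchingComplement ⟩
      sum (λ i → 1 + moved π involutive i)      ≡⟨ ∑-distrib-+ (λ _ → 1) (moved π involutive) ⟩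
      sum {n} (λ _ → 1) + sum (moved π involutive)
        ≡⟨ cong (_+ sum (moved π involutive)) (trans (sum-const n 1) (ℕ.*-identityʳ n)) ⟩
      n + sum (moved π involutive) ∎

  -- A moved vertex is not adjacent to its partner, so a full one must have its partner outside `V`.
  full⇒fixed⊎partner∉ : ∀ {V a} → FullOn G V a → π a ≡ a ⊎ π a ∉ V
  full⇒fixed⊎partner∉ {V} {a} (_ , full) with π a ≟ a
  ... | yes fixed = inj₁ fixed
  ... | no  πa≢a  = inj₂ λ πa∈ →
    proj₂ (does-true⇒ (unmatched? π involutive a (π a)) (full (π a) πa∈ πa≢a)) refl

  hub-fixed : ∀ {a} → FullOn G ⊤ a → π a ≡ a
  hub-fixed full with full⇒fixed⊎partner∉ full
  ... | inj₁ fixed = fixed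
  ... | inj₂ πa∉   = contradiction ∈⊤ πa∉

  hub-fixed⊎partner : ∀ {a x} → FullOn G (∁ ⁅ x ⁆) a → π a ≡ a ⊎ π a ≡ x
  hub-fixed⊎partner {a} {x} full with full⇒fixed⊎partner∉ full
  ... | inj₁ fixed = inj₁ fixed
  ... | inj₂ πa∉   = inj₂ (decidable-stable (π a ≟ x) (πa∉ ∘ ∈-except⁺))

-- The extremal graphs and their sizes.

partner : ∀ k a → Fin (k + a * 2) → Fin (k + a * 2)
partner zero    (suc a) zero          = suc zero
partner zero    (suc a) (suc zero)    = zero
partner zero    (suc a) (suc (suc i)) = suc (suc (partner zero a i))
partner (suc k) a       zero          = zero
partner (suc k) a       (suc i)       = suc (partner k a i)

partner-involutive : ∀ k a i → partner k a (partner k a i) ≡ i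
partner-involutive zero    (suc a) zero          = refl
partner-involutive zero    (suc a) (suc zero)    = refl
partner-involutive zero    (suc a) (suc (suc i)) = cong (λ j → suc (suc j)) (partner-involutive zero a i)
partner-involutive (suc k) a       zero          = refl
partner-involutive (suc k) a       (suc i)       = cong suc (partner-involutive k a i)

partner≢ : ∀ a i → partner zero a i ≢ i
partner≢ (suc a) (suc (suc i)) eq = partner≢ a i (suc-injective (suc-injective eq))

sum-moved : ∀ k a → sum (moved (partner k a) (partner-involutive k a)) ≡ a * 2
sum-moved zero    zero    = refl
sum-moved zero    (suc a) = cong (2 +_) (sum-moved zero a)
sum-moved (suc k) a       = sum-moved k a

-- Vertices 0 to k - 1 are unmatched; the others are matched in consecutive pairs, which costs `a`
-- edges of the complete graph.
extremal : ∀ k a → Graph (k + a * 2)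
extremal k a = matchingComplement (partner k a) (partner-involutive k a)

double-injective : ∀ {s t} → s + s ≡ t + t → s ≡ t
double-injective {s} {t} eq = ℕ.*-cancelʳ-≡ s t 2
  (trans (twice s) (trans eq (sym (twice t))))
  where
  twice : ∀ s → s * 2 ≡ s + s
  twice = solve-∀

-- The hypothesis is the handshake identity with `t` for the size, free of subtraction and division,
-- so that each instance is a polynomial identity in `m`.
size-extremal : ∀ k a {t} → t + t + (k + a * 2 + a * 2) ≡ (k + a * 2) * (k + a * 2) →
                size (extremal k a) ≡ t
size-extremal k a {t} eq = double-injective (ℕ.+-cancelʳ-≡ (k + a * 2 + a * 2) _ _ (trans
  (trans (cong (λ s → size (extremal k a) + size (extremal k a) + (k + a * 2 + s)) (sym (sum-moved k a)))
         (size-matchingComplement (partner k a) (partner-involutive k a)))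
  (sym eq)))

hub-partner : ∀ a {x h} → FullOn (extremal 0 a) (∁ ⁅ x ⁆) h → partner 0 a h ≡ x
hub-partner a {h = h} full with hub-fixed⊎partner (partner 0 a) (partner-involutive 0 a) full
... | inj₁ fixed = contradiction fixed (partner≢ a h)
... | inj₂ eq    = eq

-- Hubs of a spanning book are unmatched, and only vertex 0 is.
extremal₁-free : ∀ m (S : Sub (3 + m * 2)) → ¬ IsCopy (Book (1 + m * 2)) (extremal 1 (suc m)) S
extremal₁-free m S c =
  let (a , b , (a≢b , fullᵃ , fullᵇ) , _) = copy⇒book₂ (extremal 1 (suc m)) S c
  in a≢b (trans (only a fullᵃ) (sym (only b fullᵇ)))
  where
  only : ∀ a → FullOn (extremal 1 (suc m)) ⊤ a → a ≡ zero
  only zero    _    = refl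
  only (suc i) full = contradiction
    (suc-injective (hub-fixed (partner 1 (suc m)) (partner-involutive 1 (suc m)) full)) (partner≢ (suc m) i)

partner-injective : ∀ k a {i j} → partner k a i ≡ partner k a j → i ≡ j
partner-injective k a {i} {j} eq =
  trans (sym (partner-involutive k a i)) (trans (cong (partner k a) eq) (partner-involutive k a j))

-- All vertices are matched, so both hubs would be the partner of the omitted vertex.
extremal₀-free : ∀ m (S : Sub (4 + m * 2)) → ¬ IsCopy (Book (1 + m * 2)) (extremal 0 (2 + m)) S
extremal₀-free m S c =
  let (a , b , x , (a≢b , fullᵃ , fullᵇ) , _) = copy⇒book₃ (extremal 0 (2 + m)) S c
  in a≢b (partner-injective 0 (2 + m) (trans (hub-partner (2 + m) fullᵃ) (sym (hub-partner (2 + m) fullᵇ))))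

-- Upper bounds on the number of copies in the extremal graphs.

#copies-extremal₃≤3 : ∀ m → #copies (Book (1 + m * 2)) (extremal 3 m) ≤ 3
#copies-extremal₃≤3 m = unique⊆⇒length≤ (copies-unique (Book (1 + m * 2)) G) λ {S} S∈ →
  let (a , b , (a≢b , fullᵃ , fullᵇ) , S≡) = copy⇒book₂ G S (Equivalence.to (∈-copies (Book (1 + m * 2)) G S) S∈)
  in subst (_∈ˡ books) (sym S≡) (listed a b a≢b (fixed a fullᵃ) (fixed b fullᵇ))
  where
  G = extremal 3 m
  books : List (Sub (3 + m * 2))
  -- Hubs are unmatched, so they form a pair out of the vertices 0, 1 and 2.
  books = book zero (suc zero) ⊤ ∷ book zero (suc (suc zero)) ⊤ ∷ book (suc zero) (suc (suc zero)) ⊤ ∷ []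
  fixed : ∀ a → FullOn G ⊤ a → partner 3 m a ≡ a
  fixed a = hub-fixed (partner 3 m) (partner-involutive 3 m)
  high : ∀ i → partner 3 m (suc (suc (suc i))) ≢ suc (suc (suc i))
  high i eq = partner≢ m i (suc-injective (suc-injective (suc-injective eq)))
  listed : ∀ a b → a ≢ b → partner 3 m a ≡ a → partner 3 m b ≡ b → book a b ⊤ ∈ˡ books
  listed zero             zero             a≢b _ _ = contradiction refl a≢b
  listed zero             (suc zero)       _ _ _ = here refl
  listed zero             (suc (suc zero)) _ _ _ = there (here refl)
  listed (suc zero)       zero             _ _ _ = here (book-comm _ _ _)
  listed (suc zero)       (suc zero)       a≢b _ _ = contradiction refl a≢b
  listed (suc zero)       (suc (suc zero)) _ _ _ = there (there (here refl))
  listed (suc (suc zero)) zero             _ _ _ = there (here (book-comm _ _ _))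
  listed (suc (suc zero)) (suc zero)       _ _ _ = there (there (here (book-comm _ _ _)))
  listed (suc (suc zero)) (suc (suc zero)) a≢b _ _ = contradiction refl a≢b
  listed (suc (suc (suc i))) _ _ eq _ = contradiction eq (high i)
  listed _ (suc (suc (suc j))) _ _ eq = contradiction eq (high j)

-- With both hubs unmatched any other vertex may be omitted; with one matched hub the omitted vertex
-- is its partner. Each of the three families has 2 + 2m members.
#copies-extremal₂≤ : ∀ m → #copies (Book (1 + m * 2)) (extremal 2 (suc m)) ≤ 3 * (2 + m * 2)
#copies-extremal₂≤ m = subst (#copies (Book (1 + m * 2)) G ≤_) length-books
  (unique⊆⇒length≤ (copies-unique (Book (1 + m * 2)) G) λ {S} S∈ →
    let (a , b , x , (a≢b , fullᵃ , fullᵇ) , S≡) = copy⇒book₃ G S (Equivalence.to (∈-copies (Book (1 + m * 2)) G S) S∈)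
    in subst (_∈ˡ books) (sym S≡)
         (listed a b x a≢b (∈-except⁻ (proj₁ fullᵃ)) (∈-except⁻ (proj₁ fullᵇ)) (hub a fullᵃ) (hub b fullᵇ)))
  where
  G = extremal 2 (suc m)
  π = partner 2 (suc m)
  F = Fin (4 + m * 2)
  I = Fin (2 + m * 2)
  up : I → F
  up i = suc (suc i)
  twoHubs : I → Sub (4 + m * 2)
  twoHubs i = book zero (suc zero) (∁ ⁅ up i ⁆)
  oneHub : F → I → Sub (4 + m * 2)
  oneHub h i = book h (up i) (∁ ⁅ π (up i) ⁆)
  books : List (Sub (4 + m * 2))
  books = List.tabulate twoHubs ++ List.tabulate (oneHub zero) ++ List.tabulate (oneHub (suc zero))
  length-books : length books ≡ 3 * (2 + m * 2)
  length-books = trans (length-++ (List.tabulate twoHubs))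
    (cong₂ _+_ (length-tabulate twoHubs) (trans (length-++ (List.tabulate (oneHub zero)))
      (cong₂ _+_ (length-tabulate (oneHub zero))
        (trans (length-tabulate (oneHub (suc zero))) (sym (ℕ.+-identityʳ (2 + m * 2)))))))
  hub : ∀ {x} a → FullOn G (∁ ⁅ x ⁆) a → π a ≡ a ⊎ π a ≡ x
  hub a = hub-fixed⊎partner π (partner-involutive 2 (suc m))
  high : ∀ i → π (up i) ≢ up i
  high i eq = partner≢ (suc m) i (suc-injective (suc-injective eq))
  ∈twoHubs : ∀ i → twoHubs i ∈ˡ books
  ∈twoHubs i = ∈-++⁺ˡ (∈-tabulate⁺ {f = twoHubs} i)
  ∈oneHub₀ : ∀ i → oneHub zero i ∈ˡ books
  ∈oneHub₀ i = ∈-++⁺ʳ (List.tabulate twoHubs) (∈-++⁺ˡ (∈-tabulate⁺ {f = oneHub zero} i))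
  ∈oneHub₁ : ∀ i → oneHub (suc zero) i ∈ˡ books
  ∈oneHub₁ i = ∈-++⁺ʳ (List.tabulate twoHubs) (∈-++⁺ʳ (List.tabulate (oneHub zero)) (∈-tabulate⁺ {f = oneHub (suc zero)} i))
  flipped : ∀ a b {V} → book a b V ∈ˡ books → book b a V ∈ˡ books
  flipped a b {V} = subst (_∈ˡ books) (book-comm a b V)
  listed : ∀ a b x → a ≢ b → a ≢ x → b ≢ x → π a ≡ a ⊎ π a ≡ x → π b ≡ b ⊎ π b ≡ x →
           book a b (∁ ⁅ x ⁆) ∈ˡ books
  listed zero          zero          _ a≢b _ _ _ _ = contradiction refl a≢b
  listed (suc zero)    (suc zero)    _ a≢b _ _ _ _ = contradiction refl a≢b
  listed zero          (suc zero)    zero          _ a≢x _ _ _ = contradiction refl a≢x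
  listed zero          (suc zero)    (suc zero)    _ _ b≢x _ _ = contradiction refl b≢x
  listed zero          (suc zero)    (suc (suc i)) _ _ _ _ _ = ∈twoHubs i
  listed (suc zero)    zero          zero          _ _ b≢x _ _ = contradiction refl b≢x
  listed (suc zero)    zero          (suc zero)    _ a≢x _ _ _ = contradiction refl a≢x
  listed (suc zero)    zero          (suc (suc i)) _ _ _ _ _ = flipped zero (suc zero) (∈twoHubs i)
  listed zero          (suc (suc i)) _ _ _ _ _ (inj₁ eq)   = contradiction eq (high i)
  listed zero          (suc (suc i)) _ _ _ _ _ (inj₂ refl) = ∈oneHub₀ i
  listed (suc zero)    (suc (suc i)) _ _ _ _ _ (inj₁ eq)   = contradiction eq (high i)
  listed (suc zero)    (suc (suc i)) _ _ _ _ _ (inj₂ refl) = ∈oneHub₁ i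
  listed (suc (suc i)) zero          _ _ _ _ (inj₁ eq)   _ = contradiction eq (high i)
  listed (suc (suc i)) zero          _ _ _ _ (inj₂ refl) _ = flipped zero (up i) (∈oneHub₀ i)
  listed (suc (suc i)) (suc zero)    _ _ _ _ (inj₁ eq)   _ = contradiction eq (high i)
  listed (suc (suc i)) (suc zero)    _ _ _ _ (inj₂ refl) _ = flipped (suc zero) (up i) (∈oneHub₁ i)
  listed (suc (suc i)) (suc (suc j)) _ _ _ _ (inj₁ eq) _ = contradiction eq (high i)
  listed (suc (suc i)) (suc (suc j)) _ _ _ _ (inj₂ _) (inj₁ eq) = contradiction eq (high j)
  -- Two matched hubs would share the partner `x`.
  listed (suc (suc i)) (suc (suc j)) _ a≢b _ _ (inj₂ eq) (inj₂ eq′) =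
    contradiction (partner-injective 2 (suc m) (trans eq (sym eq′))) a≢b

-- Lower bounds on the number of copies from vertices of small codegree.

unique-map : {f : A → B} {xs : List A} →
  (∀ {x y} → x ∈ˡ xs → y ∈ˡ xs → f x ≡ f y → x ≡ y) → Unique xs → Unique (map f xs)
unique-map inj [] = []
unique-map {f = f} inj (x∉xs ∷ u) =
  All.tabulate (λ y∈ fx≡y → let (z , z∈ , y≡fz) = ∈-map⁻ f y∈ in
    All.lookup x∉xs z∈ (inj (here refl) (there z∈) (trans fx≡y y≡fz)))
  ∷ unique-map (λ x∈ y∈ → inj (there x∈) (there y∈)) u

-- Each witness may depend on the membership proof, so it is stored next to its argument instead of
-- being given by a function.
choose : {R : A → B → Set} (xs : List A) → (∀ {x} → x ∈ˡ xs → ∃ (R x)) →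
         ∃ λ qs → map proj₁ qs ≡ xs × (∀ {q} → q ∈ˡ qs → R (proj₁ q) (proj₂ q))
choose []       r = [] , refl , λ ()
choose (x ∷ xs) r with r (here refl) | choose xs (r ∘ there)
... | y , Rxy | qs , eq , Rqs = (x , y) ∷ qs , cong (x ∷_) eq , λ
  { (here refl) → Rxy
  ; (there q∈)  → Rqs q∈ }

#copies≥ : (G : Graph n) {Ss : List (Sub n)} → Unique Ss → (∀ {S} → S ∈ˡ Ss → IsCopy (Book p) G S) →
           length Ss ≤ #copies (Book p) G
#copies≥ {p = p} G u isCopy = unique⊆⇒length≤ u λ {S} S∈ → Equivalence.from (∈-copies (Book p) G S) (isCopy S∈)

module _ (G : Graph n) where

  Dominating : Fin n → Set
  Dominating u = ∀ v → v ≢ u → adj G u v ≡ true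

  dominating-full : ∀ {u} {V : Subset n} → Dominating u → u ∈ V → FullOn G V u
  dominating-full dom u∈ = u∈ , λ v _ → dom v

  dominating-pair : 2 ≤ length (ofCodegree G 1) →
    ∃₂ λ u v → u ≢ v × Dominating u × Dominating v
  dominating-pair 2≤ with ofCodegree G 1 | 2≤ | ofCodegree-unique G 1 | ∈-ofCodegree⁻ G {1}
  ... | u ∷ v ∷ _ | _ | (u≢v ∷ _) ∷ _ | deg =
    u , v , u≢v , codegree1⇒adj G (deg (here refl)) , codegree1⇒adj G (deg (there (here refl)))
  ... | _ ∷ [] | s≤s () | _ | _

  dominating-triple : 3 ≤ length (ofCodegree G 1) →
    ∃₂ λ u v → ∃ λ w → (u ≢ v × u ≢ w × v ≢ w) × Dominating u × Dominating v × Dominating w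
  dominating-triple 3≤ with ofCodegree G 1 | 3≤ | ofCodegree-unique G 1 | ∈-ofCodegree⁻ G {1}
  ... | u ∷ v ∷ w ∷ _ | _ | (u≢v ∷ u≢w ∷ _) ∷ (v≢w ∷ _) ∷ _ | deg =
    u , v , w , (u≢v , u≢w , v≢w) , codegree1⇒adj G (deg (here refl))
      , codegree1⇒adj G (deg (there (here refl))) , codegree1⇒adj G (deg (there (there (here refl))))
  ... | _ ∷ [] | s≤s () | _ | _
  ... | _ ∷ _ ∷ [] | s≤s (s≤s ()) | _ | _

pair-copy₂ : (G : Graph (2 + p)) → 2 ≤ length (ofCodegree G 1) → ∃ (IsCopy (Book p) G)
pair-copy₂ G 2≤ =
  let (u , v , u≢v , domᵘ , domᵛ) = dominating-pair G 2≤
  in book u v ⊤ , book-isCopy₂ G (u≢v , dominating-full G domᵘ ∈⊤ , dominating-full G domᵛ ∈⊤)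

-- Each pair among three dominating vertices spans a book. Any two of the pairs differ in a vertex,
-- which distinguishes the books by `book-hubs₂`.
triple-#copies₂ : (G : Graph (2 + p)) → 4 ≤ 2 + p → 3 ≤ length (ofCodegree G 1) → 3 ≤ #copies (Book p) G
triple-#copies₂ {p} G 4≤ 3≤ =
  let (u , v , w , (u≢v , u≢w , v≢w) , domᵘ , domᵛ , domʷ) = dominating-triple G 3≤
      distinct : Unique (book u v ⊤ ∷ book u w ⊤ ∷ book v w ⊤ ∷ [])
      distinct = (differ (inj₂ refl) (≢-sym u≢v) v≢w ∷ differ (inj₁ refl) u≢v u≢w ∷ [])
               ∷ (differ (inj₁ refl) u≢v u≢w ∷ [])
               ∷ [] ∷ []
  in #copies≥ G distinct (λ S∈ → All.lookup
       (copy u≢v domᵘ domᵛ ∷ copy u≢w domᵘ domʷ ∷ copy v≢w domᵛ domʷ ∷ []) S∈)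
  where
  copy : ∀ {a b} → a ≢ b → Dominating G a → Dominating G b → IsCopy (Book p) G (book a b ⊤)
  copy a≢b domᵃ domᵇ = book-isCopy₂ G (a≢b , dominating-full G domᵃ ∈⊤ , dominating-full G domᵇ ∈⊤)
  differ : {a b a′ b′ c : Fin (2 + p)} → c ≡ a ⊎ c ≡ b → c ≢ a′ → c ≢ b′ → book a b ⊤ ≢ book a′ b′ ⊤
  differ hub c≢a′ c≢b′ eq = [ c≢a′ , c≢b′ ]′ (book-hubs₂ 4≤ hub eq)

-- Any of the 1 + p vertices besides two dominating hubs may be the omitted one.
common-isBook : (G : Graph (3 + p)) {u v : Fin (3 + p)} (u≢v : u ≢ v) → Dominating G u → Dominating G v →
                ∀ i → IsBook G u v (∁ ⁅ others u≢v i ⁆)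
common-isBook G u≢v domᵘ domᵛ i =
  u≢v , dominating-full G domᵘ (∈-except⁺ (≢-sym (others≢a u≢v i)))
      , dominating-full G domᵛ (∈-except⁺ (≢-sym (others≢b u≢v i)))

pair-copy₃ : (G : Graph (3 + p)) → 2 ≤ length (ofCodegree G 1) → ∃ (IsCopy (Book p) G)
pair-copy₃ G 2≤ =
  let (u , v , u≢v , domᵘ , domᵛ) = dominating-pair G 2≤
  in book u v (∁ ⁅ others u≢v zero ⁆) , book-isCopy₃ G (common-isBook G u≢v domᵘ domᵛ zero)

module _ (G : Graph (3 + p)) (5≤ : 5 ≤ 3 + p) {u v : Fin (3 + p)} (u≢v : u ≢ v)
         (domᵘ : Dominating G u) (domᵛ : Dominating G v) where

  private
    N = 3 + p

  BookOmitting : (a b x : Fin N) → Set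
  BookOmitting a b x = IsBook G a b (∁ ⁅ x ⁆)

  -- The books with hubs u, v, those with hub u but not v, and those with hub v but not u.
  three-families : (qᵘ qᵛ : List (Fin N × Fin N)) → Unique qᵘ → Unique qᵛ →
    (∀ {q} → q ∈ˡ qᵘ → proj₁ q ≢ v × BookOmitting u (proj₁ q) (proj₂ q)) →
    (∀ {q} → q ∈ˡ qᵛ → proj₁ q ≢ u × BookOmitting v (proj₁ q) (proj₂ q)) →
    1 + p ≤ length qᵘ → 1 + p ≤ length qᵛ → 3 * (1 + p) ≤ #copies (Book p) G
  three-families qᵘ qᵛ uniqueᵘ uniqueᵛ okᵘ okᵛ longᵘ longᵛ = begin
    3 * (1 + p)
      ≡⟨ cong (λ s → (1 + p) + ((1 + p) + s)) (ℕ.+-identityʳ (1 + p)) ⟩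
    (1 + p) + ((1 + p) + (1 + p))
      ≤⟨ ℕ.+-monoʳ-≤ (1 + p) (ℕ.+-mono-≤ longᵘ longᵛ) ⟩
    (1 + p) + (length qᵘ + length qᵛ)
      ≡⟨ cong₂ _+_ (length-tabulate common) (cong₂ _+_ (length-map (only u) qᵘ) (length-map (only v) qᵛ)) ⟨
    length L₁ + (length L₂ + length L₃)
      ≡⟨ trans (length-++ L₁) (cong (length L₁ +_) (length-++ L₂)) ⟨
    length (L₁ ++ L₂ ++ L₃)
      ≤⟨ #copies≥ G (Unique.++⁺ unique₁ (Unique.++⁺ (unique-only uniqueᵘ okᵘ) (unique-only uniqueᵛ okᵛ) disjoint₂₃) disjoint₁)
                  (λ S∈ → isCopy (∈-++⁻ L₁ S∈)) ⟩
    #copies (Book p) G ∎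
    where
    open ℕ.≤-Reasoning
    common : Fin (1 + p) → Sub N
    common i = book u v (∁ ⁅ others u≢v i ⁆)
    only : Fin N → Fin N × Fin N → Sub N
    only h (w , x) = book h w (∁ ⁅ x ⁆)
    L₁ = List.tabulate common
    L₂ = map (only u) qᵘ
    L₃ = map (only v) qᵛ

    omitted-injective : ∀ {a b x a′ b′ x′ : Fin N} →
      book a b (∁ ⁅ x ⁆) ≡ book a′ b′ (∁ ⁅ x′ ⁆) → x ≡ x′
    omitted-injective {a} {b} {x} {a′} {b′} {x′} eq = except-injective
      (trans (sym (vertices-book a b _)) (trans (cong vertices eq) (vertices-book a′ b′ _)))

    unique₁ : Unique L₁
    unique₁ = Unique.tabulate⁺ λ eq → others-injective u≢v (omitted-injective {u} {v} {_} {u} {v} eq)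

    unique-only : ∀ {h k qs} → Unique qs → (∀ {q} → q ∈ˡ qs → proj₁ q ≢ k × BookOmitting h (proj₁ q) (proj₂ q)) →
                  Unique (map (only h) qs)
    -- `only h` is shown injective on pairs that form books: there `w` differs from `h` but is a hub
    -- of the second book, so it is `w′`.
    unique-only {h} {k} {qs} uniqueʰ ok = unique-map inj uniqueʰ
      where
      inj : ∀ {q r} → q ∈ˡ qs → r ∈ˡ qs → only h q ≡ only h r → q ≡ r
      inj {w , x} {w′ , x′} q∈ r∈ eq =
        let (_ , h≢w , _ , (w∈ , _)) = ok q∈
        in [ (λ w≡h → contradiction (sym w≡h) h≢w)
           , (λ w≡w′ → cong₂ _,_ w≡w′ (omitted-injective {h} {w} {x} {h} {w′} eq))
           ]′ (book-hubs₃ {a = h} {w} {h} {w′} 5≤ (inj₂ refl) (∈-except⁻ w∈) eq)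

    -- `u` is a hub throughout `L₂` and nowhere in `L₃`. Likewise, in the next two lemmas, `L₁`
    -- always has the hub `v`, absent from `L₂`, and the hub `u`, absent from `L₃`.
    disjoint₂₃ : ∀ {S} → ¬ (S ∈ˡ L₂ × S ∈ˡ L₃)
    disjoint₂₃ (S∈₂ , S∈₃) =
      let ((w  , x)  , q∈ , S≡)  = ∈-map⁻ (only u) S∈₂
          ((w′ , x′) , r∈ , S≡′) = ∈-map⁻ (only v) S∈₃
          (_ , _ , (u∈ , _) , _) = okᵘ q∈
      in [ u≢v , ≢-sym (proj₁ (okᵛ r∈)) ]′
           (book-hubs₃ {a = u} {w} {v} {w′} 5≤ (inj₁ refl) (∈-except⁻ u∈) (trans (sym S≡) S≡′))

    disjoint₁₂ : ∀ {S} → S ∈ˡ L₁ → ¬ S ∈ˡ L₂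
    disjoint₁₂ S∈₁ S∈₂ =
      let (i , S≡)              = ∈-tabulate⁻ {f = common} S∈₁
          ((w , x) , q∈ , S≡′) = ∈-map⁻ (only u) S∈₂
      in [ ≢-sym u≢v , ≢-sym (proj₁ (okᵘ q∈)) ]′
           (book-hubs₃ {a = u} {v} {u} {w} 5≤ (inj₂ refl) (≢-sym (others≢b u≢v i)) (trans (sym S≡) S≡′))

    disjoint₁₃ : ∀ {S} → S ∈ˡ L₁ → ¬ S ∈ˡ L₃
    disjoint₁₃ S∈₁ S∈₃ =
      let (i , S≡)              = ∈-tabulate⁻ {f = common} S∈₁
          ((w , x) , q∈ , S≡′) = ∈-map⁻ (only v) S∈₃
      in [ u≢v , ≢-sym (proj₁ (okᵛ q∈)) ]′
           (book-hubs₃ {a = u} {v} {v} {w} 5≤ (inj₁ refl) (≢-sym (others≢a u≢v i)) (trans (sym S≡) S≡′))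

    disjoint₁ : ∀ {S} → ¬ (S ∈ˡ L₁ × S ∈ˡ L₂ ++ L₃)
    disjoint₁ (S∈₁ , S∈) = [ disjoint₁₂ S∈₁ , disjoint₁₃ S∈₁ ]′ (∈-++⁻ L₂ S∈)

    copy : ∀ {a b x S} → S ≡ book a b (∁ ⁅ x ⁆) → BookOmitting a b x → IsCopy (Book p) G S
    copy S≡ isBook = subst (IsCopy (Book p) G) (sym S≡) (book-isCopy₃ G isBook)

    isCopy : ∀ {S} → S ∈ˡ L₁ ⊎ S ∈ˡ L₂ ++ L₃ → IsCopy (Book p) G S
    isCopy (inj₁ S∈₁) =
      let (i , S≡) = ∈-tabulate⁻ {f = common} S∈₁ in copy S≡ (common-isBook G u≢v domᵘ domᵛ i)
    isCopy (inj₂ S∈) =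
      [ (λ S∈₂ → let (_ , q∈ , S≡) = ∈-map⁻ (only u) S∈₂ in copy S≡ (proj₂ (okᵘ q∈)))
      , (λ S∈₃ → let (_ , q∈ , S≡) = ∈-map⁻ (only v) S∈₃ in copy S≡ (proj₂ (okᵛ q∈)))
      ]′ (∈-++⁻ L₂ S∈)

-- The third dominating vertex `w` serves as second hub with `u` and with `v`, each time with 1 + p
-- choices of the omitted vertex.
triple-#copies₃ : (G : Graph (3 + p)) → 5 ≤ 3 + p → 3 ≤ length (ofCodegree G 1) →
                  3 * (1 + p) ≤ #copies (Book p) G
triple-#copies₃ {p} G 5≤ 3≤ =
  let (u , v , w , (u≢v , u≢w , v≢w) , domᵘ , domᵛ , domʷ) = dominating-triple G 3≤
  in three-families G 5≤ u≢v domᵘ domᵛ (pairs u≢w) (pairs v≢w) (pairs-unique u≢w) (pairs-unique v≢w)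
       (pairs-ok u≢w domᵘ domʷ (≢-sym v≢w)) (pairs-ok v≢w domᵛ domʷ (≢-sym u≢w)) (long u≢w) (long v≢w)
  where
  pair : ∀ {h w} → h ≢ w → Fin (1 + p) → Fin (3 + p) × Fin (3 + p)
  pair {w = w} h≢w i = w , others h≢w i
  pairs : ∀ {h w} → h ≢ w → List (Fin (3 + p) × Fin (3 + p))
  pairs h≢w = List.tabulate (pair h≢w)
  pairs-unique : ∀ {h w} (h≢w : h ≢ w) → Unique (pairs h≢w)
  pairs-unique h≢w = Unique.tabulate⁺ {f = pair h≢w} λ eq → others-injective h≢w (cong proj₂ eq)
  pairs-ok : ∀ {h w k} (h≢w : h ≢ w) → Dominating G h → Dominating G w → w ≢ k → ∀ {q} → q ∈ˡ pairs h≢w →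
             proj₁ q ≢ k × IsBook G h (proj₁ q) (∁ ⁅ proj₂ q ⁆)
  pairs-ok h≢w domʰ domʷ w≢k q∈ with ∈-tabulate⁻ {f = pair h≢w} q∈
  ... | i , refl = w≢k , common-isBook G h≢w domʰ domʷ i
  long : ∀ {h w} (h≢w : h ≢ w) → 1 + p ≤ length (pairs h≢w)
  long h≢w = ℕ.≤-reflexive (sym (length-tabulate (pair h≢w)))

-- A vertex of codegree 2 becomes full once its one missing neighbour is omitted, so it is a second
-- hub for `u` and for `v`; the same list `qs` serves both families.
pair-#copies₃ : (G : Graph (3 + p)) → 5 ≤ 3 + p → 2 ≤ length (ofCodegree G 1) →
                1 + p ≤ length (ofCodegree G 2) → 3 * (1 + p) ≤ #copies (Book p) G
pair-#copies₃ {p} G 5≤ 2≤ long =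
  let (u , v , u≢v , domᵘ , domᵛ) = dominating-pair G 2≤
      (qs , map≡ , ok) = choose {R = Missing} (ofCodegree G 2) (λ w∈ → codegree2⇒adj G (∈-ofCodegree⁻ G w∈))
      unique = Unique.map⁻ (subst Unique (sym map≡) (ofCodegree-unique G 2))
      long′ = subst (1 + p ≤_) (trans (cong length (sym map≡)) (length-map proj₁ qs)) long
  in three-families G 5≤ u≢v domᵘ domᵛ qs qs unique unique
       (λ q∈ → apart domᵛ (ok q∈) , isBook domᵘ (ok q∈))
       (λ q∈ → apart domᵘ (ok q∈) , isBook domᵛ (ok q∈)) long′ long′
  where
  Missing : Fin (3 + p) → Fin (3 + p) → Set
  Missing w x = x ≢ w × adj G w x ≡ false × (∀ v → v ≢ w → v ≢ x → adj G w v ≡ true)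
  apart : ∀ {h w x} → Dominating G h → Missing w x → w ≢ h
  apart domʰ (x≢w , ¬adj , _) refl = contradiction (trans (sym (domʰ _ x≢w)) ¬adj) λ ()
  isBook : ∀ {h w x} → Dominating G h → Missing w x → IsBook G h w (∁ ⁅ x ⁆)
  isBook {h} {w} {x} domʰ missing@(x≢w , ¬adj , full) =
    h≢w , dominating-full G domʰ (∈-except⁺ h≢x) , ∈-except⁺ (≢-sym x≢w) , λ v v∈ v≢w → full v v≢w (∈-except⁻ v∈)
    where
    h≢w : h ≢ w
    h≢w = ≢-sym (apart domʰ missing)
    -- A dominating `h` is adjacent to `w`, whereas `x` is not.
    h≢x : h ≢ x
    h≢x refl = contradiction (trans (sym (domʰ w (≢-sym h≢w))) (trans (symmetric G h w) ¬adj)) λ ()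

-- Counting vertices of small codegree in graphs above the Turán number.

dominating-count≥ : ∀ {s d} (G : Graph n) → s ≤ size G → s + s + n * 2 ≡ n * n + d →
                    d ≤ length (ofCodegree G 1)
-- `twice-order≤` and the handshake identity bound the count below by 2s + 2n - n², which `eq` names
-- `d`.
dominating-count≥ {n} {s} {d} G s≤ eq = ℕ.+-cancelˡ-≤ (n * n) d _ (begin
  n * n + d                                   ≡⟨ eq ⟨
  s + s + n * 2                               ≤⟨ ℕ.+-mono-≤ (ℕ.+-mono-≤ s≤ s≤) (twice-order≤ G) ⟩
  size G + size G + (sum (codegree G) + D)    ≡⟨ ℕ.+-assoc (size G + size G) _ D ⟨
  size G + size G + sum (codegree G) + D      ≡⟨ cong (_+ D) (handshake G) ⟩
  n * n + D                                   ∎)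
  where
  open ℕ.≤-Reasoning
  D = length (ofCodegree G 1)

near-dominating-count≥ : ∀ {s e} (G : Graph n) → s ≤ size G → length (ofCodegree G 1) ≤ 2 →
                         s + s + n * 3 ≡ n * n + 4 + e → e ≤ length (ofCodegree G 2)
near-dominating-count≥ {n} {s} {e} G s≤ D≤2 eq = ℕ.+-cancelˡ-≤ (n * n + 4) e _ (begin
  n * n + 4 + e                                     ≡⟨ eq ⟨
  s + s + n * 3                                     ≤⟨ ℕ.+-mono-≤ (ℕ.+-mono-≤ s≤ s≤) (thrice-order≤ G) ⟩
  size G + size G + (sum (codegree G) + (D + D) + E) ≡⟨ regroup (size G) (sum (codegree G)) (D + D) E ⟩
  size G + size G + sum (codegree G) + (D + D) + E  ≡⟨ cong (λ t → t + (D + D) + E) (handshake G) ⟩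
  n * n + (D + D) + E                               ≤⟨ ℕ.+-monoˡ-≤ E (ℕ.+-monoʳ-≤ (n * n) (ℕ.+-mono-≤ D≤2 D≤2)) ⟩
  n * n + 4 + E                                     ∎)
  where
  open ℕ.≤-Reasoning
  D = length (ofCodegree G 1)
  E = length (ofCodegree G 2)
  regroup : ∀ s c d e → s + s + (c + d + e) ≡ s + s + c + d + e
  regroup = solve-∀

-- C(p+2,2) - (m+1) and C(p+3,2) - (m+2) for p = 1 + 2m: complements of matchings with as few unmatched
-- vertices as parity allows.
turán₂ turán₃ : ℕ → ℕ
turán₂ m = 2 * ((1 + m) * (1 + m))
turán₃ m = 2 * ((1 + m) * (2 + m))

-- The excess 2s + 2n - n² does not depend on `m`: it is 3 here and 2 in `dominating-count₃`.
dominating-count₂ : ∀ m (G : Graph (3 + m * 2)) → 1 + turán₂ m ≤ size G → 3 ≤ length (ofCodegree G 1)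
dominating-count₂ m G large = dominating-count≥ G large (identity m)
  where
  identity : ∀ m → (1 + 2 * ((1 + m) * (1 + m))) + (1 + 2 * ((1 + m) * (1 + m))) + (3 + m * 2) * 2
                 ≡ (3 + m * 2) * (3 + m * 2) + 3
  identity = solve-∀

dominating-count₃ : ∀ m (G : Graph (4 + m * 2)) → 1 + turán₃ m ≤ size G → 2 ≤ length (ofCodegree G 1)
dominating-count₃ m G large = dominating-count≥ G large (identity m)
  where
  identity : ∀ m → (1 + 2 * ((1 + m) * (2 + m))) + (1 + 2 * ((1 + m) * (2 + m))) + (4 + m * 2) * 2
                 ≡ (4 + m * 2) * (4 + m * 2) + 2
  identity = solve-∀

near-dominating-count₃ : ∀ m (G : Graph (4 + m * 2)) → 1 + turán₃ m ≤ size G →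
  length (ofCodegree G 1) ≤ 2 → 2 + m * 2 ≤ length (ofCodegree G 2)
near-dominating-count₃ m G large D≤2 = near-dominating-count≥ G large D≤2 (identity m)
  where
  identity : ∀ m → (1 + 2 * ((1 + m) * (2 + m))) + (1 + 2 * ((1 + m) * (2 + m))) + (4 + m * 2) * 3
                 ≡ (4 + m * 2) * (4 + m * 2) + 4 + (2 + m * 2)
  identity = solve-∀

-- The Turán numbers and the minimum numbers of copies.

isTurán₂ : ∀ m → IsTuránNumber (3 + m * 2) (Book (1 + m * 2)) (turán₂ m)
isTurán₂ m =
    (extremal 1 (suc m) , size-extremal 1 (suc m) (identity m) , extremal₁-free m)
  , λ k (G , size≡k , free) → ℕ.≮⇒≥ λ large →
      let (S , c) = pair-copy₂ G (ℕ.≤-trans (ℕ.n≤1+n 2) (dominating-count₂ m G (subst (1 + turán₂ m ≤_) (sym size≡k) large)))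
      in free S c
  where
  identity : ∀ m → 2 * ((1 + m) * (1 + m)) + 2 * ((1 + m) * (1 + m)) + (1 + (1 + m) * 2 + (1 + m) * 2)
                 ≡ (1 + (1 + m) * 2) * (1 + (1 + m) * 2)
  identity = solve-∀

isTurán₃ : ∀ m → IsTuránNumber (4 + m * 2) (Book (1 + m * 2)) (turán₃ m)
isTurán₃ m =
    -- The order is even, so a perfect matching can be removed.
    (extremal 0 (2 + m) , size-extremal 0 (2 + m) (identity m) , extremal₀-free m)
  , λ k (G , size≡k , free) → ℕ.≮⇒≥ λ large →
      let (S , c) = pair-copy₃ G (dominating-count₃ m G (subst (1 + turán₃ m ≤_) (sym size≡k) large))
      in free S c
  where
  identity : ∀ m → 2 * ((1 + m) * (2 + m)) + 2 * ((1 + m) * (2 + m)) + ((2 + m) * 2 + (2 + m) * 2)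
                 ≡ ((2 + m) * 2) * ((2 + m) * 2)
  identity = solve-∀

#copies₂≥ : ∀ m → 3 ≤ 1 + m * 2 → (G : Graph (3 + m * 2)) → size G ≡ 1 + turán₂ m →
            3 ≤ #copies (Book (1 + m * 2)) G
#copies₂≥ m 3≤p G size≡ =
  triple-#copies₂ G (ℕ.≤-trans (ℕ.n≤1+n 4) (s≤s (s≤s 3≤p))) (dominating-count₂ m G (ℕ.≤-reflexive (sym size≡)))

#copies₃≥ : ∀ m → 3 ≤ 1 + m * 2 → (G : Graph (4 + m * 2)) → size G ≡ 1 + turán₃ m →
            3 * (2 + m * 2) ≤ #copies (Book (1 + m * 2)) G
-- Either a third dominating vertex exists, or there are at most two and enough vertices have
-- codegree 2.
#copies₃≥ m 3≤p G size≡ = [ triple-#copies₃ G 5≤ , pair ]′ (ℕ.<-≤-connex 2 (length (ofCodegree G 1)))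
  where
  5≤ : 5 ≤ 4 + m * 2
  5≤ = ℕ.≤-trans (ℕ.n≤1+n 5) (s≤s (s≤s (s≤s 3≤p)))
  large : 1 + turán₃ m ≤ size G
  large = ℕ.≤-reflexive (sym size≡)
  pair : length (ofCodegree G 1) ≤ 2 → 3 * (2 + m * 2) ≤ #copies (Book (1 + m * 2)) G
  pair D≤2 = pair-#copies₃ G 5≤ (dominating-count₃ m G large) (near-dominating-count₃ m G large D≤2)

-- Dropping one edge of the matching behind `extremal 1 (suc m)` adds one edge to the graph and
-- leaves three unmatched vertices.
isMinimum₂ : ∀ m → 3 ≤ 1 + m * 2 → IsMinimumCopies (Book (1 + m * 2)) (3 + m * 2) (1 + turán₂ m) 3
isMinimum₂ m 3≤p =
    (G , size≡ , ℕ.≤-antisym (#copies-extremal₃≤3 m) (#copies₂≥ m 3≤p G size≡))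
  , λ { _ (H , size≡ , refl) → #copies₂≥ m 3≤p H size≡ }
  where
  G = extremal 3 m
  identity : ∀ m → (1 + 2 * ((1 + m) * (1 + m))) + (1 + 2 * ((1 + m) * (1 + m))) + (3 + m * 2 + m * 2)
                 ≡ (3 + m * 2) * (3 + m * 2)
  identity = solve-∀
  size≡ : size G ≡ 1 + turán₂ m
  size≡ = size-extremal 3 m (identity m)

-- One edge fewer in the perfect matching leaves exactly two unmatched vertices.
isMinimum₃ : ∀ m → 3 ≤ 1 + m * 2 →
             IsMinimumCopies (Book (1 + m * 2)) (4 + m * 2) (1 + turán₃ m) (3 * (2 + m * 2))
isMinimum₃ m 3≤p =
    (G , size≡ , ℕ.≤-antisym (#copies-extremal₂≤ m) (#copies₃≥ m 3≤p G size≡))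
  , λ { _ (H , size≡ , refl) → #copies₃≥ m 3≤p H size≡ }
  where
  G = extremal 2 (suc m)
  identity : ∀ m → (1 + 2 * ((1 + m) * (2 + m))) + (1 + 2 * ((1 + m) * (2 + m))) + (2 + (1 + m) * 2 + (1 + m) * 2)
                 ≡ (2 + (1 + m) * 2) * (2 + (1 + m) * 2)
  identity = solve-∀
  size≡ : size G ≡ 1 + turán₃ m
  size≡ = size-extremal 2 (suc m) (identity m)

theorem4 : ∀ (p : ℕ) → p ≥ 3 → p % 2 ≡ 1 →
    (∃ λ ex → IsTuránNumber (2 + p) (Book p) ex
    × IsMinimumCopies (Book p) (2 + p) (1 + ex) 3)
    ×
    (∃ λ ex → IsTuránNumber (3 + p) (Book p) ex
    × IsMinimumCopies (Book p) (3 + p) (1 + ex) (3 * (1 + p)))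
-- Oddness is used as p = 1 + 2m with m = `p / 2`.
theorem4 p p≥3 odd = odd-case (p / 2) (trans (m≡m%n+[m/n]*n p 2) (cong (_+ p / 2 * 2) odd)) p≥3
  where
  odd-case : ∀ {p} m → p ≡ 1 + m * 2 → p ≥ 3 →
    (∃ λ ex → IsTuránNumber (2 + p) (Book p) ex
    × IsMinimumCopies (Book p) (2 + p) (1 + ex) 3)
    ×
    (∃ λ ex → IsTuránNumber (3 + p) (Book p) ex
    × IsMinimumCopies (Book p) (3 + p) (1 + ex) (3 * (1 + p)))
  odd-case m refl p≥3 =
    (turán₂ m , isTurán₂ m , isMinimum₂ m p≥3) , (turán₃ m , isTurán₃ m , isMinimum₃ m p≥3)
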